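{- If $D$ is an arc-weighted directed multigraph, then $\tau_t(D)\le 1.8\,\nu^*_t(D)$.
   Context: A directed multigraph may contain parallel arcs and bigons (but no loops). It is arc-weighted if each arc $e$ has a non-negative weight $w(e)$. A (directed) triangle is a triple of arcs of the form $uv, vw, wu$ on three distinct vertices; $T(D)$ is the set of triangles. $\tau_t(D)$ is the minimum total weight of a set $F$ of arcs such that $D\setminus F$ contains no directed triangle. A fractional triangle packing is a function $m:T(D)\to[0,\infty)$ such that for every arc $e$, the sum of $m(T)$ over triangles $T$ containing $e$ is at most $w(e)$; its weight is $\sum_{T\in T(D)} m(T)$, and $\nu^*_t(D)$ is the maximum weight of a fractional triangle packing.
   Formalization: The arc weights are taken to be non-negative rational numbers rather than non-negative reals (the fractional packing obtained then also has rational values). -}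

module Defs where

open import Data.Nat using (ℕ; zero; suc)
import Data.Nat as ℕ
open import Data.Fin using (Fin; toℕ; zero; suc)
open import Data.Bool using (Bool; true; false; if_then_else_)
open import Data.Rational using (ℚ; 0ℚ; _+_; _*_; _≤_; _/_)
open import Data.Product using (_×_; Σ; ∃; _,_)
open import Data.Sum using (_⊎_)
open import Relation.Binary.PropositionalEquality using (_≡_; _≢_)
open import Relation.Nullary using (¬_)

record Digraph : Set where
  field
    n    : ℕ
    k    : ℕ
    tail : Fin k → Fin n
    head : Fin k → Fin n
    noLoop : ∀ e → tail e ≢ head e
open Digraph public

Σℚ : ∀ {m} → (Fin m → ℚ) → ℚ
Σℚ {zero}  f = 0ℚ
Σℚ {suc m} f = f zero + Σℚ (λ i → f (suc i))

IsTri : (D : Digraph) → Fin (k D) → Fin (k D) → Fin (k D) → Set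
IsTri D a b c =
  (head D a ≡ tail D b) × (head D b ≡ tail D c) × (head D c ≡ tail D a) ×
  (tail D a ≢ tail D b) × (tail D b ≢ tail D c) × (tail D a ≢ tail D c)

-- Canonical representative of a triangle (a set of three arcs): among the
-- three cyclic rotations (a,b,c),(b,c,a),(c,a,b), the one whose first arc
-- has the smallest index.  Each triangle of T(D) corresponds to exactly one
-- canonical triple.
IsCanonTri : (D : Digraph) → Fin (k D) → Fin (k D) → Fin (k D) → Set
IsCanonTri D a b c = IsTri D a b c × (toℕ a ℕ.< toℕ b) × (toℕ a ℕ.< toℕ c)

Weight : Digraph → Set
Weight D = Fin (k D) → ℚ

NonNegW : (D : Digraph) → Weight D → Set
NonNegW D w = ∀ e → 0ℚ ≤ w e

ArcSet : Digraph → Set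
ArcSet D = Fin (k D) → Bool

wSet : (D : Digraph) → Weight D → ArcSet D → ℚ
wSet D w F = Σℚ (λ e → if F e then w e else 0ℚ)

TriFree : (D : Digraph) → ArcSet D → Set
TriFree D F = ∀ a b c → IsTri D a b c →
  (F a ≡ true) ⊎ (F b ≡ true) ⊎ (F c ≡ true)

-- Triangle-valued functions, indexed by canonical triples of arcs.
TriFun : Digraph → Set
TriFun D = Fin (k D) → Fin (k D) → Fin (k D) → ℚ

open import Data.Fin using (_≟_)
open import Relation.Nullary using (Dec; yes; no)

contains : ∀ {m} → Fin m → Fin m → Fin m → Fin m → Bool
contains e a b c with e ≟ a | e ≟ b | e ≟ c
... | no _ | no _ | no _ = false
... | _    | _    | _    = true

load : (D : Digraph) → TriFun D → Fin (k D) → ℚ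
load D m e = Σℚ (λ a → Σℚ (λ b → Σℚ (λ c →
  if contains e a b c then m a b c else 0ℚ)))

packWeight : (D : Digraph) → TriFun D → ℚ
packWeight D m = Σℚ (λ a → Σℚ (λ b → Σℚ (λ c → m a b c)))

IsFracPacking : (D : Digraph) → Weight D → TriFun D → Set
IsFracPacking D w m =
  (∀ a b c → 0ℚ ≤ m a b c) ×
  (∀ a b c → ¬ (m a b c ≡ 0ℚ) → IsCanonTri D a b c) ×
  (∀ e → load D m e ≤ w e)

{-# OPTIONS --safe #-}

-- Let x be an optimal fractional cover of the triangles by arcs and y an optimal
-- fractional packing, with equal values by linear programming duality. Round 27 x(e) to a
-- level l(e) ∈ {0,…,9}, the number of odd numbers at most 27 x(e) (capped at 9), label the
-- vertices by independent uniform s ∈ {0,…,4}, and cut the arc uv unless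
-- s(v) - s(u) > l(uv) - 5. The differences s(v) - s(u) around a triangle add up to 0, while
-- the levels of a covered triangle add up to at least 13, so every triangle loses an arc.
-- An arc with x(e) = 0 is never cut, and all other arcs are saturated by y, so the expected
-- weight of the cut is the sum over T of y(T) times the expected number of cut arcs of T.
-- If y(T) > 0, the x-values on T add up to exactly 1, and a finite check of the possible
-- levels shows that this expected number is at most 45/25 = 9/5.
module Submission where

open import Defs
open import Data.Integer using (+_)
open import Data.Rational using (_≤_; _*_; _/_)
open import Data.Product using (Σ; _×_)
open import Algebra.Bundles using (CommutativeRing)
import Algebra.Properties.CommutativeMonoid.Sum as CMSum
import Algebra.Properties.Semiring.Sum as SRSum
open import Data.Bool using (Bool; true; false; if_then_else_; T)
open import Data.Empty using (⊥; ⊥-elim)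
open import Data.Fin using (Fin; zero; suc; toℕ; _↑ˡ_; _↑ʳ_; combine; remQuot)
import Data.Fin.Properties as Fin
open import Data.List using (List; []; _∷_; _++_; map; filter; cartesianProductWith; tabulate)
open import Data.List.Membership.Propositional using (_∈_)
open import Data.List.Membership.Propositional.Properties using (∈-map⁺; ∈-map⁻; ∈-++⁺ˡ; ∈-++⁺ʳ; ∈-++⁻; ∈-filter⁺; ∈-filter⁻; ∈-cartesianProductWith⁺; ∈-cartesianProductWith⁻; ∈-tabulate⁺; ∈-tabulate⁻)
open import Data.List.Relation.Unary.Any using (here; there)
open import Data.Nat as ℕ using (ℕ; zero; suc; z≤n; s≤s; _⊓_; _≤ᵇ_)
import Data.Nat.Properties as ℕ
import Data.Nat.Solver as ℕSolver
open import Data.Product using (_,_; proj₁; proj₂; map₂)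
open import Data.Rational as ℚ using (ℚ; 0ℚ; 1ℚ; _+_; _-_; -_; _<_; 1/_; ≢-nonZero; nonNegative; positive; negative)
import Data.Rational.Properties as ℚ
open import Data.Rational.Solver using (module +-*-Solver)
open import Data.Sum using (_⊎_; inj₁; inj₂; [_,_]′)
open import Data.Vec.Functional as Vector using (Vector)
open import Function using (_∘_; id)
open import Relation.Binary using (tri<; tri≈; tri>)
open import Relation.Binary.PropositionalEquality using (_≡_; _≢_; _≗_; refl; sym; trans; cong; cong₂; subst; subst₂; module ≡-Reasoning)
open import Relation.Nullary using (¬_; Dec; yes; no)
open import Relation.Nullary.Decidable using (_→-dec_; _×-dec_; ¬?; from-yes; does)
open CMSum ℚ.+-0-commutativeMonoid using (sum; sum-cong-≗; sum-replicate-zero; ∑-distrib-+; ∑-comm)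
open SRSum (CommutativeRing.semiring ℚ.+-*-commutativeRing) using (*-distribˡ-sum; *-distribʳ-sum)
open +-*-Solver using (solve; _:+_; _:*_; _:-_; :-_; con; _:=_)

-- Order and inverses of rational numbers

≤-from-difference : ∀ {p q r} → 0ℚ ≤ r → r ≡ q - p → p ≤ q
≤-from-difference {p} {q} 0≤r eq = subst₂ _≤_ (ℚ.+-identityˡ p)
  (solve 2 (λ p q → (q :- p) :+ p := q) refl p q)
  (ℚ.+-monoˡ-≤ p (subst (0ℚ ≤_) eq 0≤r))

0≤q-p : ∀ {p q} → p ≤ q → 0ℚ ≤ q - p
0≤q-p {p} {q} p≤q = subst (_≤ q - p) (ℚ.+-inverseʳ p) (ℚ.+-monoˡ-≤ (- p) p≤q)

0≤p+q : ∀ {p q} → 0ℚ ≤ p → 0ℚ ≤ q → 0ℚ ≤ p + q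
0≤p+q = ℚ.+-mono-≤

0≤p*q : ∀ {p q} → 0ℚ ≤ p → 0ℚ ≤ q → 0ℚ ≤ p * q
0≤p*q {p} {q} 0≤p 0≤q = subst (_≤ p * q) (ℚ.*-zeroʳ p)
  (ℚ.*-monoˡ-≤-nonNeg p {{nonNegative 0≤p}} 0≤q)

0≤-p : ∀ {p} → p ≤ 0ℚ → 0ℚ ≤ - p
0≤-p = ℚ.neg-antimono-≤

-- With the junk value inv 0 = 0.
inv : ℚ → ℚ
inv p with p ℚ.≟ 0ℚ
... | yes _   = 0ℚ
... | no p≢0 = 1/_ p {{≢-nonZero p≢0}}

*-inv : ∀ {p} → p ≢ 0ℚ → p * inv p ≡ 1ℚ
*-inv {p} p≢0 with p ℚ.≟ 0ℚ
... | yes p≡0 = ⊥-elim (p≢0 p≡0)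
... | no p≢0′ = ℚ.*-inverseʳ p {{≢-nonZero p≢0′}}

0≤inv : ∀ {p} → 0ℚ < p → 0ℚ ≤ inv p
0≤inv {p} 0<p with p ℚ.≟ 0ℚ
... | yes _   = ℚ.≤-refl
... | no p≢0 = ℚ.<⇒≤ (ℚ.positive⁻¹ (1/_ p {{≢-nonZero p≢0}})
  {{ℚ.1/pos⇒pos p {{positive 0<p}} }})

inv≤0 : ∀ {p} → p < 0ℚ → inv p ≤ 0ℚ
inv≤0 {p} p<0 with p ℚ.≟ 0ℚ
... | yes _   = ℚ.≤-refl
... | no p≢0 = ℚ.<⇒≤ (ℚ.negative⁻¹ (1/_ p {{≢-nonZero p≢0}})
  {{ℚ.1/neg⇒neg p {{negative p<0}} }})

-- The choice of a value for one eliminated variable. The minimum of 0 and the upper bounds is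
-- raised to each lower bound in turn; this never passes an upper bound, because every lower bound
-- is below every upper one. Starting from 0 allows either list to be empty.
separate : (L U : List ℚ) → (∀ {l u} → l ∈ L → u ∈ U → l ≤ u) →
  Σ ℚ λ x → (∀ {l} → l ∈ L → l ≤ x) × (∀ {u} → u ∈ U → x ≤ u)
separate [] [] _ = 0ℚ , (λ ()) , (λ ())
separate [] (u ∷ U) _ with x , _ , x≤ ← separate [] U (λ ()) =
  u ℚ.⊓ x , (λ ()) , λ where
    (here refl) → ℚ.p⊓q≤p u x
    (there v∈U) → ℚ.≤-trans (ℚ.p⊓q≤q u x) (x≤ v∈U)
separate (l ∷ L) U L≤U with x , ≤x , x≤ ← separate L U (L≤U ∘ there) =
  l ℚ.⊔ x ,
  (λ where
    (here refl) → ℚ.p≤p⊔q l x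
    (there k∈L) → ℚ.≤-trans (≤x k∈L) (ℚ.p≤q⊔p l x)) ,
  λ u∈U → ℚ.⊔-lub (L≤U (here refl) u∈U) (x≤ u∈U)

-- Fourier–Motzkin elimination

-- An affine form `f` stands for the inequality `0ℚ ≤ eval f z`, and a list of forms for a system of
-- such inequalities.
record Form (n : ℕ) : Set where
  constructor form
  field
    coef  : Vector ℚ n
    const : ℚ
open Form

eval : ∀ {n} → Form n → Vector ℚ n → ℚ
eval f z = sum (λ i → coef f i * z i) + const f

infixl 6 _⊕_
infixl 7 _⊙_

_⊕_ : ∀ {n} → Form n → Form n → Form n
f ⊕ g = form (λ i → coef f i + coef g i) (const f + const g)

_⊙_ : ∀ {n} → ℚ → Form n → Form n
c ⊙ f = form (λ i → c * coef f i) (c * const f)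

eval-⊕ : ∀ {n} (f g : Form n) z → eval (f ⊕ g) z ≡ eval f z + eval g z
eval-⊕ f g z = trans
  (cong (_+ (const f + const g)) (trans
    (sum-cong-≗ (λ i → ℚ.*-distribʳ-+ (z i) (coef f i) (coef g i)))
    (∑-distrib-+ (λ i → coef f i * z i) (λ i → coef g i * z i))))
  (solve 4 (λ a b c d → (a :+ b) :+ (c :+ d) := (a :+ c) :+ (b :+ d)) refl
    (sum (λ i → coef f i * z i)) (sum (λ i → coef g i * z i)) (const f) (const g))

eval-⊙ : ∀ {n} c (f : Form n) z → eval (c ⊙ f) z ≡ c * eval f z
eval-⊙ c f z = trans
  (cong (_+ c * const f) (trans
    (sum-cong-≗ (λ i → ℚ.*-assoc c (coef f i) (z i)))
    (sym (*-distribˡ-sum c (λ i → coef f i * z i)))))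
  (sym (ℚ.*-distribˡ-+ c _ _))

-- The inequalities derivable from `S` by nonnegative combination. Coefficient vectors are
-- functions, so `≗-resp` identifies forms that agree pointwise.
data Cone {n} (S : List (Form n)) : Form n → Set where
  gen   : ∀ {f} → f ∈ S → Cone S f
  add   : ∀ {f g} → Cone S f → Cone S g → Cone S (f ⊕ g)
  scale : ∀ {c f} → 0ℚ ≤ c → Cone S f → Cone S (c ⊙ f)
  ≗-resp  : ∀ {f g} → coef f ≗ coef g → const f ≡ const g → Cone S f → Cone S g

tailForm : ∀ {n} → Form (suc n) → Form n
tailForm f = form (coef f ∘ suc) (const f)

0∷_ : ∀ {n} → Form n → Form (suc n)
0∷ f = form (0ℚ Vector.∷ coef f) (const f)

eval-∷ : ∀ {n} (f : Form (suc n)) x z →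
  eval f (x Vector.∷ z) ≡ coef f zero * x + eval (tailForm f) z
eval-∷ f x z = ℚ.+-assoc (coef f zero * x) (sum (λ i → coef f (suc i) * z i)) (const f)

module _ {n : ℕ} where

  -- Meant for a positive leading coefficient in `f` and a negative one in `g`: both multipliers are
  -- then positive and the leading terms cancel.
  eliminant : Form (suc n) → Form (suc n) → Form (suc n)
  eliminant f g = (- coef g zero) ⊙ f ⊕ coef f zero ⊙ g

  zero? : (f : Form (suc n)) → Dec (coef f zero ≡ 0ℚ)
  zero? f = coef f zero ℚ.≟ 0ℚ

  positive? : (f : Form (suc n)) → Dec (0ℚ < coef f zero)
  positive? f = 0ℚ ℚ.<? coef f zero

  negative? : (f : Form (suc n)) → Dec (coef f zero < 0ℚ)
  negative? f = coef f zero ℚ.<? 0ℚ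

  zeros positives negatives : List (Form (suc n)) → List (Form (suc n))
  zeros     = filter zero?
  positives = filter positive?
  negatives = filter negative?

  eliminants : List (Form (suc n)) → List (Form (suc n))
  eliminants S = cartesianProductWith eliminant (positives S) (negatives S)

  eliminate : List (Form (suc n)) → List (Form n)
  eliminate S = map tailForm (zeros S ++ eliminants S)

  -ba+ab≡0 : ∀ a b → (- b) * a + a * b ≡ 0ℚ
  -ba+ab≡0 = solve 2 (λ a b → (:- b) :* a :+ a :* b := con 0ℚ) refl

  -- Each form of the eliminated system is a nonnegative combination of forms of `S` in which the
  -- first variable cancels. Hence a refutation after elimination lifts to a refutation of `S`.
  Cone-eliminate : ∀ {S f} → Cone (eliminate S) f → Cone S (0∷ f)
  Cone-eliminate {S} (gen f∈) with ∈-map⁻ tailForm f∈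
  ... | g , g∈ , refl with ∈-++⁻ (zeros S) g∈
  ...   | inj₁ g∈zeros
    with g∈S , g₀≡0 ← ∈-filter⁻ zero? {xs = S} g∈zeros =
    ≗-resp (λ { zero → g₀≡0 ; (suc i) → refl }) refl (gen g∈S)
  ...   | inj₂ g∈eliminants
    with h , k , h∈ , k∈ , refl ←
      ∈-cartesianProductWith⁻ eliminant (positives S) (negatives S) g∈eliminants
    with h∈S , 0<h₀ ← ∈-filter⁻ positive? {xs = S} h∈
    with k∈S , k₀<0 ← ∈-filter⁻ negative? {xs = S} k∈ =
    ≗-resp
      (λ { zero → -ba+ab≡0 (coef h zero) (coef k zero)
         ; (suc i) → refl })
      refl
      (add (scale (0≤-p (ℚ.<⇒≤ k₀<0)) (gen h∈S)) (scale (ℚ.<⇒≤ 0<h₀) (gen k∈S)))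
  Cone-eliminate (add p q) =
    ≗-resp (λ { zero → refl ; (suc i) → refl }) refl
      (add (Cone-eliminate p) (Cone-eliminate q))
  Cone-eliminate (scale {c} 0≤c p) =
    ≗-resp (λ { zero → ℚ.*-zeroʳ c ; (suc i) → refl }) refl
      (scale 0≤c (Cone-eliminate p))
  Cone-eliminate (≗-resp eq eq′ p) =
    ≗-resp (λ { zero → refl ; (suc i) → eq i }) eq′ (Cone-eliminate p)

  -- With `i` and `j` the inverses of `f₀ > 0` and `g₀ < 0`, the factor `i * (- j)` is positive. It
  -- turns the value of the eliminant into the upper bound from `g` minus the lower bound from `f`.
  cross-multiply : ∀ f₀ g₀ F G i j → f₀ * i ≡ 1ℚ → g₀ * j ≡ 1ℚ →
    ((- g₀) * F + f₀ * G) * (i * (- j)) ≡ (- G) * j - (- F) * i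
  cross-multiply f₀ g₀ F G i j f₀i≡1 g₀j≡1 = begin
    ((- g₀) * F + f₀ * G) * (i * (- j))
      ≡⟨ solve 6 (λ f₀ g₀ F G i j →
           ((:- g₀) :* F :+ f₀ :* G) :* (i :* (:- j)) :=
           (:- G) :* j :* (f₀ :* i) :+ F :* i :* (g₀ :* j)) refl f₀ g₀ F G i j ⟩
    (- G) * j * (f₀ * i) + F * i * (g₀ * j)
      ≡⟨ cong₂ (λ u v → (- G) * j * u + F * i * v) f₀i≡1 g₀j≡1 ⟩
    (- G) * j * 1ℚ + F * i * 1ℚ
      ≡⟨ solve 4 (λ F G i j → (:- G) :* j :* con 1ℚ :+ F :* i :* con 1ℚ :=
           (:- G) :* j :- (:- F) :* i) refl F G i j ⟩
    (- G) * j - (- F) * i ∎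
    where open ≡-Reasoning

  factor : ∀ f₀ F i x → f₀ * i ≡ 1ℚ → f₀ * (x - (- F) * i) ≡ f₀ * x + F
  factor f₀ F i x f₀i≡1 = begin
    f₀ * (x - (- F) * i)
      ≡⟨ solve 4 (λ f₀ F i x → f₀ :* (x :- (:- F) :* i) := f₀ :* x :+ F :* (f₀ :* i))
           refl f₀ F i x ⟩
    f₀ * x + F * (f₀ * i)
      ≡⟨ cong (λ u → f₀ * x + F * u) f₀i≡1 ⟩
    f₀ * x + F * 1ℚ
      ≡⟨ cong (λ a → f₀ * x + a) (ℚ.*-identityʳ F) ⟩
    f₀ * x + F ∎
    where open ≡-Reasoning

  flip-signs : ∀ p q r → (- p) * (q - r) ≡ p * (r - q)
  flip-signs = solve 3 (λ p q r → (:- p) :* (q :- r) := p :* (r :- q)) refl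

  module _ (S : List (Form (suc n))) (z : Vector ℚ n)
           (solves : ∀ {f} → f ∈ eliminate S → 0ℚ ≤ eval f z) where

    rest : Form (suc n) → ℚ
    rest f = eval (tailForm f) z

    -- The value of the first variable at which `f` vanishes when its leading coefficient is
    -- nonzero: a lower bound if that coefficient is positive, an upper bound if it is negative.
    bound : Form (suc n) → ℚ
    bound f = (- rest f) * inv (coef f zero)

    bound-≤ : ∀ {f g} → f ∈ positives S → g ∈ negatives S → bound f ≤ bound g
    bound-≤ {f} {g} f∈ g∈ = ≤-from-difference
      (0≤p*q
        (subst (0ℚ ≤_)
          (trans (eval-⊕ (tailForm ((- g₀) ⊙ f)) (tailForm (f₀ ⊙ g)) z)
            (cong₂ _+_ (eval-⊙ (- g₀) (tailForm f) z) (eval-⊙ f₀ (tailForm g) z)))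
          (solves (∈-map⁺ tailForm (∈-++⁺ʳ (zeros S) (∈-cartesianProductWith⁺ eliminant f∈ g∈)))))
        (0≤p*q (0≤inv 0<f₀) (0≤-p (inv≤0 g₀<0))))
      (cross-multiply f₀ g₀ (rest f) (rest g) (inv f₀) (inv g₀)
        (*-inv (ℚ.<⇒≢ 0<f₀ ∘ sym)) (*-inv (ℚ.<⇒≢ g₀<0)))
      where
      f₀ = coef f zero
      g₀ = coef g zero
      0<f₀ : 0ℚ < f₀
      0<f₀ = proj₂ (∈-filter⁻ positive? {xs = S} f∈)
      g₀<0 : g₀ < 0ℚ
      g₀<0 = proj₂ (∈-filter⁻ negative? {xs = S} g∈)

    -- As a function of the first variable, `f` is its leading coefficient times the distance from
    -- its root, so its sign is determined by the side of the root on which `x` lies.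
    coef*[x-bound] : ∀ f x → coef f zero ≢ 0ℚ →
      coef f zero * (x - bound f) ≡ eval f (x Vector.∷ z)
    coef*[x-bound] f x f₀≢0 = trans
      (factor (coef f zero) (rest f) (inv (coef f zero)) x (*-inv f₀≢0))
      (sym (eval-∷ f x z))

    module _ (x : ℚ) (≤x : ∀ {l} → l ∈ map bound (positives S) → l ≤ x)
             (x≤ : ∀ {u} → u ∈ map bound (negatives S) → x ≤ u) where

      satisfied : ∀ {f} → f ∈ S → 0ℚ ≤ eval f (x Vector.∷ z)
      satisfied {f} f∈S with ℚ.<-cmp (coef f zero) 0ℚ
      ... | tri≈ _ f₀≡0 _ = subst (0ℚ ≤_)
        (sym (trans (eval-∷ f x z)
          (trans (cong (λ u → u * x + rest f) f₀≡0)
            (trans (cong (_+ rest f) (ℚ.*-zeroˡ x)) (ℚ.+-identityˡ (rest f))))))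
        (solves (∈-map⁺ tailForm (∈-++⁺ˡ (∈-filter⁺ zero? f∈S f₀≡0))))
      ... | tri> _ f₀≢0 0<f₀ = subst (0ℚ ≤_) (coef*[x-bound] f x (f₀≢0))
        (0≤p*q (ℚ.<⇒≤ 0<f₀) (0≤q-p (≤x (∈-map⁺ bound (∈-filter⁺ positive? f∈S 0<f₀)))))
      ... | tri< f₀<0 f₀≢0 _ = subst (0ℚ ≤_)
        (trans (flip-signs (coef f zero) (bound f) x) (coef*[x-bound] f x f₀≢0))
        (0≤p*q (0≤-p (ℚ.<⇒≤ f₀<0)) (0≤q-p (x≤ (∈-map⁺ bound (∈-filter⁺ negative? f∈S f₀<0)))))

    bounds-≤ : ∀ {l u} → l ∈ map bound (positives S) → u ∈ map bound (negatives S) → l ≤ u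
    bounds-≤ l∈ u∈ with ∈-map⁻ bound l∈ | ∈-map⁻ bound u∈
    ... | f , f∈ , refl | g , g∈ , refl = bound-≤ f∈ g∈

    extend : Σ ℚ λ x → ∀ {f} → f ∈ S → 0ℚ ≤ eval f (x Vector.∷ z)
    extend with x , ≤x , x≤ ← separate (map bound (positives S)) (map bound (negatives S)) bounds-≤
      = x , satisfied x ≤x x≤

Solvable Refutable : ∀ {n} → List (Form n) → Set
Solvable {n} S = Σ (Vector ℚ n) λ z → ∀ {f} → f ∈ S → 0ℚ ≤ eval f z
-- A Farkas certificate: the inequalities combine to the assertion that a negative constant is
-- nonnegative.
Refutable S = Σ ℚ λ δ → δ < 0ℚ × Cone S (form (λ _ → 0ℚ) δ)

-- Farkas' lemma, by eliminating one variable at a time. Solutions extend back through `extend`,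
-- certificates through `Cone-eliminate`; with no variables left, every form is a constant and a
-- negative one is itself a certificate.
solvable⊎refutable : ∀ n (S : List (Form n)) → Solvable S ⊎ Refutable S
solvable⊎refutable zero [] = inj₁ ((λ ()) , λ ())
solvable⊎refutable zero (f ∷ S) with const f ℚ.<? 0ℚ | solvable⊎refutable zero S
... | yes f<0 | _ = inj₂ (const f , f<0 , ≗-resp (λ ()) refl (gen (here refl)))
... | no f≮0 | inj₁ (z , solves) = inj₁ (z , λ where
  (here refl) → subst (0ℚ ≤_) (sym (ℚ.+-identityˡ _)) (ℚ.≮⇒≥ f≮0)
  (there g∈)  → solves g∈)
... | no _ | inj₂ (δ , δ<0 , c) = inj₂ (δ , δ<0 , weaken c)
  where
  weaken : ∀ {g} → Cone S g → Cone (f ∷ S) g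
  weaken (gen g∈)     = gen (there g∈)
  weaken (add p q)    = add (weaken p) (weaken q)
  weaken (scale c p)  = scale c (weaken p)
  weaken (≗-resp e e′ p) = ≗-resp e e′ (weaken p)
solvable⊎refutable (suc n) S with solvable⊎refutable n (eliminate S)
... | inj₁ (z , solves) = let x , satisfied = extend S z solves in
  inj₁ (x Vector.∷ z , satisfied)
... | inj₂ (δ , δ<0 , c) =
  inj₂ (δ , δ<0 , ≗-resp (λ { zero → refl ; (suc i) → refl }) refl (Cone-eliminate c))

-- Linear programming duality

sum-mono : ∀ {n} {f g : Vector ℚ n} → (∀ i → f i ≤ g i) → sum f ≤ sum g
sum-mono {zero}  f≤g = ℚ.≤-refl
sum-mono {suc n} f≤g = ℚ.+-mono-≤ (f≤g zero) (sum-mono (f≤g ∘ suc))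

sum-nonneg : ∀ {n} {f : Vector ℚ n} → (∀ i → 0ℚ ≤ f i) → 0ℚ ≤ sum f
sum-nonneg {zero}  0≤f = ℚ.≤-refl
sum-nonneg {suc n} 0≤f = 0≤p+q (0≤f zero) (sum-nonneg (0≤f ∘ suc))

nonneg-sum≤0 : ∀ {n} (f : Vector ℚ n) → (∀ i → 0ℚ ≤ f i) → sum f ≤ 0ℚ → ∀ i → f i ≡ 0ℚ
nonneg-sum≤0 f 0≤f Σ≤0 zero = ℚ.≤-antisym
  (ℚ.≤-trans (≤-from-difference (sum-nonneg (0≤f ∘ suc))
    (solve 2 (λ a s → s := (a :+ s) :- a) refl (f zero) (sum (f ∘ suc)))) Σ≤0)
  (0≤f zero)
nonneg-sum≤0 f 0≤f Σ≤0 (suc i) = nonneg-sum≤0 (f ∘ suc) (0≤f ∘ suc)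
  (ℚ.≤-trans (≤-from-difference (0≤f zero)
    (solve 2 (λ a s → a := (a :+ s) :- s) refl (f zero) (sum (f ∘ suc)))) Σ≤0) i

sum-↑ : ∀ m {n} (f : Vector ℚ (m ℕ.+ n)) →
  sum f ≡ sum (λ i → f (i ↑ˡ n)) + sum (λ j → f (m ↑ʳ j))
sum-↑ zero    f = sym (ℚ.+-identityˡ _)
sum-↑ (suc m) f = trans (cong (λ a → f zero + a) (sum-↑ m (f ∘ suc)))
  (sym (ℚ.+-assoc (f zero) _ _))

infix 8 _·_
_·_ : ∀ {n} → Vector ℚ n → Vector ℚ n → ℚ
u · v = sum (λ i → u i * v i)

0s : ∀ {n} → Vector ℚ n
0s _ = 0ℚ

δ : ∀ {n} → Fin n → Vector ℚ n
δ zero    zero    = 1ℚ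
δ zero    (suc j) = 0ℚ
δ (suc i) zero    = 0ℚ
δ (suc i) (suc j) = δ i j

0≤δ : ∀ {n} (i j : Fin n) → 0ℚ ≤ δ i j
0≤δ zero    zero    = ℚ.nonNegative⁻¹ 1ℚ
0≤δ zero    (suc j) = ℚ.≤-refl
0≤δ (suc i) zero    = ℚ.≤-refl
0≤δ (suc i) (suc j) = 0≤δ i j

0·≡0 : ∀ {n} (v : Vector ℚ n) → 0s · v ≡ 0ℚ
0·≡0 {n} v = trans (sum-cong-≗ (λ i → ℚ.*-zeroˡ (v i))) (sum-replicate-zero n)

δ·≡ : ∀ {n} (i : Fin n) v → δ i · v ≡ v i
δ·≡ zero v = trans (cong₂ _+_ (ℚ.*-identityˡ (v zero)) (0·≡0 (v ∘ suc))) (ℚ.+-identityʳ _)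
δ·≡ (suc i) v = trans (cong₂ _+_ (ℚ.*-zeroˡ (v zero)) (δ·≡ i (v ∘ suc))) (ℚ.+-identityˡ _)

·-comm : ∀ {n} (u v : Vector ℚ n) → u · v ≡ v · u
·-comm u v = sum-cong-≗ (λ i → ℚ.*-comm (u i) (v i))

·-distribʳ-+ : ∀ {n} (w u v : Vector ℚ n) → (λ i → u i + v i) · w ≡ u · w + v · w
·-distribʳ-+ w u v = trans (sum-cong-≗ (λ i → ℚ.*-distribʳ-+ (w i) (u i) (v i)))
  (∑-distrib-+ (λ i → u i * w i) (λ i → v i * w i))

·-distribˡ-+ : ∀ {n} (w u v : Vector ℚ n) → w · (λ i → u i + v i) ≡ w · u + w · v
·-distribˡ-+ w u v = trans (·-comm w _)
  (trans (·-distribʳ-+ w u v) (cong₂ _+_ (·-comm u w) (·-comm v w)))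

·-assoc : ∀ {n} c (u v : Vector ℚ n) → (λ i → c * u i) · v ≡ c * u · v
·-assoc c u v = trans (sum-cong-≗ (λ i → ℚ.*-assoc c (u i) (v i)))
  (sym (*-distribˡ-sum c (λ i → u i * v i)))

·-neg : ∀ {n} (u v : Vector ℚ n) → u · (λ i → - v i) ≡ - (u · v)
·-neg u v = trans (sum-cong-≗ (λ i → lemma (u i) (v i)))
  (trans (sym (*-distribˡ-sum (- 1ℚ) (λ i → u i * v i))) (-1* (u · v)))
  where
  lemma : ∀ p q → p * (- q) ≡ (- 1ℚ) * (p * q)
  lemma = solve 2 (λ p q → p :* (:- q) := (:- con 1ℚ) :* (p :* q)) refl
  -1* : ∀ p → (- 1ℚ) * p ≡ - p
  -1* = solve 1 (λ p → (:- con 1ℚ) :* p := :- p) refl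

·-monoʳ : ∀ {n} (u : Vector ℚ n) {v w} → (∀ i → 0ℚ ≤ u i) → (∀ i → v i ≤ w i) → u · v ≤ u · w
·-monoʳ u 0≤u v≤w =
  sum-mono (λ i → ℚ.*-monoˡ-≤-nonNeg (u i) {{nonNegative (0≤u i)}} (v≤w i))

-- Interchange of two finite sums, in the shape that serves the duality arguments, the averages over
-- labels, and the double counting of arcs in triangles.
·-exchange : ∀ {m n} (u : Vector ℚ m) (v : Vector ℚ n) (A : Fin n → Fin m → ℚ) →
  u · (λ i → v · (λ j → A j i)) ≡ v · (λ j → u · A j)
·-exchange u v A = begin
  sum (λ i → u i * sum (λ j → v j * A j i))
    ≡⟨ sum-cong-≗ (λ i → *-distribˡ-sum (u i) (λ j → v j * A j i)) ⟩
  sum (λ i → sum (λ j → u i * (v j * A j i)))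
    ≡⟨ ∑-comm (λ i j → u i * (v j * A j i)) ⟩
  sum (λ j → sum (λ i → u i * (v j * A j i)))
    ≡⟨ sum-cong-≗ (λ j → sum-cong-≗ (λ i → swap (u i) (v j) (A j i))) ⟩
  sum (λ j → sum (λ i → v j * (u i * A j i)))
    ≡⟨ sum-cong-≗ (λ j → *-distribˡ-sum (v j) (λ i → u i * A j i)) ⟨
  sum (λ j → v j * sum (λ i → u i * A j i)) ∎
  where
  open ≡-Reasoning
  swap : ∀ p q r → p * (q * r) ≡ q * (p * r)
  swap = solve 3 (λ p q r → p :* (q :* r) := q :* (p :* r)) refl

-- The covering program minimizes `x · c` and the packing program maximizes `y · b`. Columns of `A`
-- belong to the covering variables, rows to the packing variables.
module LinearProgram {N M : ℕ} (A : Fin M → Fin N → ℚ) (b : Vector ℚ M) (c : Vector ℚ N) where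

  column : Fin N → Vector ℚ M
  column j i = A i j

  Covers : Vector ℚ N → Set
  Covers x = (∀ j → 0ℚ ≤ x j) × (∀ i → b i ≤ x · A i)

  Packs : Vector ℚ M → Set
  Packs y = (∀ i → 0ℚ ≤ y i) × (∀ j → y · column j ≤ c j)

  blocks : Vector ℚ N → Vector ℚ M → ℚ → Form (N ℕ.+ M)
  blocks u v = form (u Vector.++ v)

  private
    ++-↑ˡ : ∀ (u : Vector ℚ N) (v : Vector ℚ M) j → (u Vector.++ v) (j ↑ˡ M) ≡ u j
    ++-↑ˡ u v j rewrite Fin.splitAt-↑ˡ N j M = refl

    ++-↑ʳ : ∀ (u : Vector ℚ N) (v : Vector ℚ M) i → (u Vector.++ v) (N ↑ʳ i) ≡ v i
    ++-↑ʳ u v i rewrite Fin.splitAt-↑ʳ N M i = refl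

  eval-blocks : ∀ u v d z → eval (blocks u v d) z ≡
    u · (λ j → z (j ↑ˡ M)) + v · (λ i → z (N ↑ʳ i)) + d
  eval-blocks u v d z = cong (_+ d) (trans (sum-↑ N (λ k → (u Vector.++ v) k * z k))
    (cong₂ _+_
      (sum-cong-≗ (λ j → cong (_* z (j ↑ˡ M)) (++-↑ˡ u v j)))
      (sum-cong-≗ (λ i → cong (_* z (N ↑ʳ i)) (++-↑ʳ u v i)))))

  x≥0 capacity : Fin N → Form (N ℕ.+ M)
  x≥0 j      = blocks (δ j) 0s 0ℚ
  capacity j = blocks 0s (λ i → - column j i) (c j)

  y≥0 cover : Fin M → Form (N ℕ.+ M)
  y≥0 i   = blocks 0s (δ i) 0ℚ
  cover i = blocks (A i) 0s (- b i)

  gap : Form (N ℕ.+ M)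
  gap = blocks (λ j → - c j) b 0ℚ

  -- Both programs are solved at once, in the joint variables `x` and `y`. The form `gap` demands
  -- `x · c ≤ y · b`; weak duality is the reverse inequality, so a solution is a pair of optima.
  system : List (Form (N ℕ.+ M))
  system = gap ∷ tabulate x≥0 ++ tabulate y≥0 ++ tabulate cover ++ tabulate capacity

  -- The coefficientwise form of
  -- f ≥ Σ p i · cover i + Σ q j · capacity j + t · gap on the nonnegative orthant.
  record Multipliers (f : Form (N ℕ.+ M)) : Set where
    field
      q      : Vector ℚ N
      p      : Vector ℚ M
      t      : ℚ
      0≤q    : ∀ j → 0ℚ ≤ q j
      0≤p    : ∀ i → 0ℚ ≤ p i
      0≤t    : 0ℚ ≤ t
      x-coef : ∀ j → p · column j - t * c j ≤ coef f (j ↑ˡ M)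
      y-coef : ∀ i → t * b i - q · A i ≤ coef f (N ↑ʳ i)
      const≥ : q · c - p · b ≤ const f

  private
    0-0*≡0 : ∀ {a} d → a ≡ 0ℚ → a - 0ℚ * d ≡ 0ℚ
    0-0*≡0 d refl = cong (λ u → 0ℚ - u) (ℚ.*-zeroˡ d)
    0*-0≡0 : ∀ {a} d → a ≡ 0ℚ → 0ℚ * d - a ≡ 0ℚ
    0*-0≡0 d refl = cong (λ u → u - 0ℚ) (ℚ.*-zeroˡ d)
    a-0*≡a : ∀ a d → a - 0ℚ * d ≡ a
    a-0*≡a a d = trans (cong (λ u → a - u) (ℚ.*-zeroˡ d)) (ℚ.+-identityʳ a)
    0*-a≡-a : ∀ a d → 0ℚ * d - a ≡ - a
    0*-a≡-a a d = trans (cong (λ u → u - a) (ℚ.*-zeroˡ d)) (ℚ.+-identityˡ (- a))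
    0-≡- : ∀ {a d e} → a ≡ 0ℚ → d ≡ e → a - d ≡ - e
    0-≡- refl refl = ℚ.+-identityˡ _
    0-0≡ : ∀ {a d} → a ≡ 0ℚ → d ≡ 0ℚ → a - d ≡ 0ℚ
    0-0≡ refl refl = refl
    -0≡ : ∀ {a d e} → a ≡ e → d ≡ 0ℚ → a - d ≡ e
    -0≡ {e = e} refl refl = ℚ.+-identityʳ e

  -- The nonnegativity forms get no multiplier of their own: the slack in `x-coef` and `y-coef`
  -- absorbs them, so all of `q`, `p`, `t` can be zero here.
  x≥0-multipliers : ∀ j → Multipliers (x≥0 j)
  x≥0-multipliers j = record
    { q = 0s ; p = 0s ; t = 0ℚ
    ; 0≤q = λ _ → ℚ.≤-refl ; 0≤p = λ _ → ℚ.≤-refl ; 0≤t = ℚ.≤-refl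
    ; x-coef = λ k → subst₂ _≤_ (sym (0-0*≡0 (c k) (0·≡0 (column k)))) (sym (++-↑ˡ (δ j) 0s k)) (0≤δ j k)
    ; y-coef = λ i → ℚ.≤-reflexive (trans (0*-0≡0 (b i) (0·≡0 (A i))) (sym (++-↑ʳ (δ j) 0s i)))
    ; const≥ = ℚ.≤-reflexive (0-0≡ (0·≡0 c) (0·≡0 b))
    }

  y≥0-multipliers : ∀ i → Multipliers (y≥0 i)
  y≥0-multipliers i = record
    { q = 0s ; p = 0s ; t = 0ℚ
    ; 0≤q = λ _ → ℚ.≤-refl ; 0≤p = λ _ → ℚ.≤-refl ; 0≤t = ℚ.≤-refl
    ; x-coef = λ j → ℚ.≤-reflexive (trans (0-0*≡0 (c j) (0·≡0 (column j))) (sym (++-↑ˡ 0s (δ i) j)))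
    ; y-coef = λ k → subst₂ _≤_ (sym (0*-0≡0 (b k) (0·≡0 (A k)))) (sym (++-↑ʳ 0s (δ i) k)) (0≤δ i k)
    ; const≥ = ℚ.≤-reflexive (0-0≡ (0·≡0 c) (0·≡0 b))
    }

  cover-multipliers : ∀ i → Multipliers (cover i)
  cover-multipliers i = record
    { q = 0s ; p = δ i ; t = 0ℚ
    ; 0≤q = λ _ → ℚ.≤-refl ; 0≤p = 0≤δ i ; 0≤t = ℚ.≤-refl
    ; x-coef = λ j → ℚ.≤-reflexive
        (trans (trans (a-0*≡a _ (c j)) (δ·≡ i (column j))) (sym (++-↑ˡ (A i) 0s j)))
    ; y-coef = λ k → ℚ.≤-reflexive (trans (0*-0≡0 (b k) (0·≡0 (A k))) (sym (++-↑ʳ (A i) 0s k)))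
    ; const≥ = ℚ.≤-reflexive (0-≡- (0·≡0 c) (δ·≡ i b))
    }

  capacity-multipliers : ∀ j → Multipliers (capacity j)
  capacity-multipliers j = record
    { q = δ j ; p = 0s ; t = 0ℚ
    ; 0≤q = 0≤δ j ; 0≤p = λ _ → ℚ.≤-refl ; 0≤t = ℚ.≤-refl
    ; x-coef = λ k → ℚ.≤-reflexive
        (trans (0-0*≡0 (c k) (0·≡0 (column k))) (sym (++-↑ˡ 0s (λ i → - column j i) k)))
    ; y-coef = λ i → ℚ.≤-reflexive
        (trans (trans (0*-a≡-a _ (b i)) (cong -_ (δ·≡ j (A i))))
          (sym (++-↑ʳ 0s (λ i → - column j i) i)))
    ; const≥ = ℚ.≤-reflexive (-0≡ (δ·≡ j c) (0·≡0 b))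
    }

  gap-multipliers : Multipliers gap
  gap-multipliers = record
    { q = 0s ; p = 0s ; t = 1ℚ
    ; 0≤q = λ _ → ℚ.≤-refl ; 0≤p = λ _ → ℚ.≤-refl ; 0≤t = ℚ.nonNegative⁻¹ 1ℚ
    ; x-coef = λ j → ℚ.≤-reflexive
        (trans (0-≡- (0·≡0 (column j)) (ℚ.*-identityˡ (c j))) (sym (++-↑ˡ (λ j → - c j) b j)))
    ; y-coef = λ i → ℚ.≤-reflexive
        (trans (-0≡ (ℚ.*-identityˡ (b i)) (0·≡0 (A i))) (sym (++-↑ʳ (λ j → - c j) b i)))
    ; const≥ = ℚ.≤-reflexive (0-0≡ (0·≡0 c) (0·≡0 b))
    }

  ⊕-multipliers : ∀ {f g} → Multipliers f → Multipliers g → Multipliers (f ⊕ g)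
  ⊕-multipliers m₁ m₂ = record
    { q = λ j → M₁.q j + M₂.q j ; p = λ i → M₁.p i + M₂.p i ; t = M₁.t + M₂.t
    ; 0≤q = λ j → 0≤p+q (M₁.0≤q j) (M₂.0≤q j)
    ; 0≤p = λ i → 0≤p+q (M₁.0≤p i) (M₂.0≤p i)
    ; 0≤t = 0≤p+q M₁.0≤t M₂.0≤t
    ; x-coef = λ j → subst (_≤ _)
        (sym (trans (cong (_- _) (·-distribʳ-+ (column j) M₁.p M₂.p))
          (regroupˡ (M₁.p · column j) (M₂.p · column j) M₁.t M₂.t (c j))))
        (ℚ.+-mono-≤ (M₁.x-coef j) (M₂.x-coef j))
    ; y-coef = λ i → subst (_≤ _)
        (sym (trans (cong (λ u → (M₁.t + M₂.t) * b i - u) (·-distribʳ-+ (A i) M₁.q M₂.q))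
          (regroupʳ (M₁.q · A i) (M₂.q · A i) M₁.t M₂.t (b i))))
        (ℚ.+-mono-≤ (M₁.y-coef i) (M₂.y-coef i))
    ; const≥ = subst (_≤ _)
        (sym (trans (cong₂ _-_ (·-distribʳ-+ c M₁.q M₂.q) (·-distribʳ-+ b M₁.p M₂.p))
          (regroup (M₁.q · c) (M₂.q · c) (M₁.p · b) (M₂.p · b))))
        (ℚ.+-mono-≤ M₁.const≥ M₂.const≥)
    }
    where
    module M₁ = Multipliers m₁
    module M₂ = Multipliers m₂
    regroupˡ : ∀ a a′ t t′ d → (a + a′) - (t + t′) * d ≡ (a - t * d) + (a′ - t′ * d)
    regroupˡ = solve 5 (λ a a′ t t′ d →
      (a :+ a′) :- (t :+ t′) :* d := (a :- t :* d) :+ (a′ :- t′ :* d)) refl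
    regroupʳ : ∀ a a′ t t′ d → (t + t′) * d - (a + a′) ≡ (t * d - a) + (t′ * d - a′)
    regroupʳ = solve 5 (λ a a′ t t′ d →
      (t :+ t′) :* d :- (a :+ a′) := (t :* d :- a) :+ (t′ :* d :- a′)) refl
    regroup : ∀ a a′ d d′ → (a + a′) - (d + d′) ≡ (a - d) + (a′ - d′)
    regroup = solve 4 (λ a a′ d d′ → (a :+ a′) :- (d :+ d′) := (a :- d) :+ (a′ :- d′)) refl

  ⊙-multipliers : ∀ {r f} → 0ℚ ≤ r → Multipliers f → Multipliers (r ⊙ f)
  ⊙-multipliers {r} 0≤r m = record
    { q = λ j → r * m.q j ; p = λ i → r * m.p i ; t = r * m.t
    ; 0≤q = λ j → 0≤p*q 0≤r (m.0≤q j)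
    ; 0≤p = λ i → 0≤p*q 0≤r (m.0≤p i)
    ; 0≤t = 0≤p*q 0≤r m.0≤t
    ; x-coef = λ j → subst (_≤ _)
        (trans (regroupˡ r (m.p · column j) m.t (c j)) (sym (cong (_- _) (·-assoc r m.p (column j)))))
        (scaled (m.x-coef j))
    ; y-coef = λ i → subst (_≤ _)
        (trans (regroupʳ r (m.q · A i) m.t (b i)) (sym (cong (λ u → r * m.t * b i - u) (·-assoc r m.q (A i)))))
        (scaled (m.y-coef i))
    ; const≥ = subst (_≤ _)
        (trans (regroup r (m.q · c) (m.p · b)) (sym (cong₂ _-_ (·-assoc r m.q c) (·-assoc r m.p b))))
        (scaled m.const≥)
    }
    where
    module m = Multipliers m
    scaled : ∀ {u v} → u ≤ v → r * u ≤ r * v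
    scaled = ℚ.*-monoˡ-≤-nonNeg r {{nonNegative 0≤r}}
    regroupˡ : ∀ r a t d → r * (a - t * d) ≡ r * a - r * t * d
    regroupˡ = solve 4 (λ r a t d → r :* (a :- t :* d) := r :* a :- r :* t :* d) refl
    regroupʳ : ∀ r a t d → r * (t * d - a) ≡ r * t * d - r * a
    regroupʳ = solve 4 (λ r a t d → r :* (t :* d :- a) := r :* t :* d :- r :* a) refl
    regroup : ∀ r a d → r * (a - d) ≡ r * a - r * d
    regroup = solve 3 (λ r a d → r :* (a :- d) := r :* a :- r :* d) refl

  ≗-multipliers : ∀ {f g} → coef f ≗ coef g → const f ≡ const g → Multipliers f → Multipliers g
  ≗-multipliers eq eq′ m = record
    { q = m.q ; p = m.p ; t = m.t ; 0≤q = m.0≤q ; 0≤p = m.0≤p ; 0≤t = m.0≤t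
    ; x-coef = λ j → subst (_ ≤_) (eq _) (m.x-coef j)
    ; y-coef = λ i → subst (_ ≤_) (eq _) (m.y-coef i)
    ; const≥ = subst (_ ≤_) eq′ m.const≥
    }
    where module m = Multipliers m

  generator-multipliers : ∀ {f} → f ∈ system → Multipliers f
  generator-multipliers (here refl) = gap-multipliers
  generator-multipliers (there f∈) with ∈-++⁻ (tabulate x≥0) f∈
  ... | inj₁ f∈₁ with j , refl ← ∈-tabulate⁻ f∈₁ = x≥0-multipliers j
  ... | inj₂ f∈₂ with ∈-++⁻ (tabulate y≥0) f∈₂
  ...   | inj₁ f∈₃ with i , refl ← ∈-tabulate⁻ f∈₃ = y≥0-multipliers i
  ...   | inj₂ f∈₄ with ∈-++⁻ (tabulate cover) f∈₄
  ...     | inj₁ f∈₅ with i , refl ← ∈-tabulate⁻ f∈₅ = cover-multipliers i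
  ...     | inj₂ f∈₆ with j , refl ← ∈-tabulate⁻ f∈₆ = capacity-multipliers j

  -- For a refutation, whose coefficients vanish and whose constant is negative, the multipliers
  -- satisfy `p · column j ≤ t * c j`, `t * b i ≤ q · A i` and `q · c < p · b`: a packing and a
  -- cover up to the scale `t`.
  cone-multipliers : ∀ {f} → Cone system f → Multipliers f
  cone-multipliers (gen f∈)        = generator-multipliers f∈
  cone-multipliers (add p q)       = ⊕-multipliers (cone-multipliers p) (cone-multipliers q)
  cone-multipliers (scale 0≤r p)   = ⊙-multipliers 0≤r (cone-multipliers p)
  cone-multipliers (≗-resp e e′ p) = ≗-multipliers e e′ (cone-multipliers p)

  x≥0∈ : ∀ j → x≥0 j ∈ system
  x≥0∈ j = there (∈-++⁺ˡ (∈-tabulate⁺ j))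

  y≥0∈ : ∀ i → y≥0 i ∈ system
  y≥0∈ i = there (∈-++⁺ʳ (tabulate x≥0) (∈-++⁺ˡ (∈-tabulate⁺ i)))

  cover∈ : ∀ i → cover i ∈ system
  cover∈ i = there (∈-++⁺ʳ (tabulate x≥0) (∈-++⁺ʳ (tabulate y≥0) (∈-++⁺ˡ (∈-tabulate⁺ i))))

  capacity∈ : ∀ j → capacity j ∈ system
  capacity∈ j = there (∈-++⁺ʳ (tabulate x≥0)
    (∈-++⁺ʳ (tabulate y≥0) (∈-++⁺ʳ (tabulate cover) (∈-tabulate⁺ j))))

  Optimal : Set
  Optimal = Σ (Vector ℚ N) λ x → Σ (Vector ℚ M) λ y → Covers x × Packs y × x · c ≤ y · b

  optimal-if-solvable : Solvable system → Optimal
  optimal-if-solvable (z , solves) = x , y , (0≤x , covers) , (0≤y , packs) , no-gap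
    where
    x : Vector ℚ N
    x j = z (j ↑ˡ M)
    y : Vector ℚ M
    y i = z (N ↑ʳ i)
    at : ∀ u v d → blocks u v d ∈ system → 0ℚ ≤ u · x + v · y + d
    at u v d f∈ = subst (0ℚ ≤_) (eval-blocks u v d z) (solves f∈)
    drop-right : ∀ a d {p} → p ≡ 0ℚ → a + p + d ≡ a + d
    drop-right a d refl = cong (_+ d) (ℚ.+-identityʳ a)
    drop-left : ∀ p d {a} → a ≡ 0ℚ → a + p + d ≡ p + d
    drop-left p d refl = cong (_+ d) (ℚ.+-identityˡ p)
    0≤x : ∀ j → 0ℚ ≤ x j
    0≤x j = subst (0ℚ ≤_)
      (trans (drop-right (δ j · x) 0ℚ (0·≡0 y)) (trans (ℚ.+-identityʳ _) (δ·≡ j x)))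
      (at (δ j) 0s 0ℚ (x≥0∈ j))
    0≤y : ∀ i → 0ℚ ≤ y i
    0≤y i = subst (0ℚ ≤_)
      (trans (drop-left (δ i · y) 0ℚ (0·≡0 x)) (trans (ℚ.+-identityʳ _) (δ·≡ i y)))
      (at 0s (δ i) 0ℚ (y≥0∈ i))
    covers : ∀ i → b i ≤ x · A i
    covers i = ≤-from-difference (at (A i) 0s (- b i) (cover∈ i))
      (trans (drop-right (A i · x) (- b i) (0·≡0 y)) (cong (_- b i) (·-comm (A i) x)))
    packs : ∀ j → y · column j ≤ c j
    packs j = ≤-from-difference (at 0s (λ i → - column j i) (c j) (capacity∈ j))
      (trans (drop-left ((λ i → - column j i) · y) (c j) (0·≡0 x))
        (trans (cong (_+ c j) (trans (·-comm (λ i → - column j i) y) (·-neg y (column j))))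
          (ℚ.+-comm (- (y · column j)) (c j))))
    no-gap : x · c ≤ y · b
    no-gap = ≤-from-difference (at (λ j → - c j) b 0ℚ (here refl))
      (trans (ℚ.+-identityʳ _)
        (trans (cong₂ _+_ (trans (·-comm (λ j → - c j) x) (·-neg x c)) (·-comm b y))
          (ℚ.+-comm (- (x · c)) (y · b))))

  -- A refutation with t > 0 is, after division by t, itself a pair of optimal
  -- solutions; one with t = 0 contradicts the feasibility of both programs.
  optimal-if-refutable : ∀ {x₀ y₀} → Covers x₀ → Packs y₀ → Refutable system → Optimal
  optimal-if-refutable {x₀} {y₀} (0≤x₀ , covers₀) (0≤y₀ , packs₀) (ε , ε<0 , cone) =
    by-cases (ℚ._≟_ t 0ℚ)
    where
    open Multipliers (cone-multipliers cone)
    pA≤tc : ∀ j → p · column j ≤ t * c j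
    pA≤tc j = ≤-from-difference (0≤-p (x-coef j))
      (solve 2 (λ a d → :- (a :- d) := d :- a) refl (p · column j) (t * c j))
    tb≤Aq : ∀ i → t * b i ≤ q · A i
    tb≤Aq i = ≤-from-difference (0≤-p (y-coef i))
      (solve 2 (λ a d → :- (a :- d) := d :- a) refl (t * b i) (q · A i))
    qc<pb : q · c < p · b
    qc<pb = subst₂ _<_
      (solve 2 (λ a d → (a :- d) :+ d := a) refl (q · c) (p · b)) (ℚ.+-identityˡ (p · b))
      (ℚ.+-monoˡ-< (p · b) (ℚ.≤-<-trans const≥ ε<0))
    by-cases : Dec (t ≡ 0ℚ) → Optimal
    by-cases (yes t≡0) = ⊥-elim (ℚ.<-irrefl refl (ℚ.<-≤-trans qc<pb (ℚ.≤-trans pb≤0 0≤qc)))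
      where
      t*≡0 : ∀ u → t * u ≡ 0ℚ
      t*≡0 u = trans (cong (_* u) t≡0) (ℚ.*-zeroˡ u)
      -- At `t = 0` every `p · column j` is at most 0, and pairing with the feasible cover `x₀`
      -- transfers this to `p · b`. Pairing with the feasible packing `y₀` gives `0 ≤ q · c` in the
      -- same way.
      pb≤0 : p · b ≤ 0ℚ
      pb≤0 = begin
        p · b                           ≤⟨ ·-monoʳ p 0≤p covers₀ ⟩
        p · (λ i → x₀ · A i)            ≡⟨ ·-exchange p x₀ column ⟩
        x₀ · (λ j → p · column j)       ≤⟨ ·-monoʳ x₀ 0≤x₀ pA≤tc ⟩
        x₀ · (λ j → t * c j)            ≤⟨ ·-monoʳ x₀ 0≤x₀ (ℚ.≤-reflexive ∘ t*≡0 ∘ c) ⟩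
        x₀ · 0s                         ≡⟨ trans (·-comm x₀ 0s) (0·≡0 x₀) ⟩
        0ℚ                              ∎
        where open ℚ.≤-Reasoning
      0≤qc : 0ℚ ≤ q · c
      0≤qc = begin
        0ℚ                              ≡⟨ trans (·-comm y₀ 0s) (0·≡0 y₀) ⟨
        y₀ · 0s                         ≤⟨ ·-monoʳ y₀ 0≤y₀ (ℚ.≤-reflexive ∘ sym ∘ t*≡0 ∘ b) ⟩
        y₀ · (λ i → t * b i)            ≤⟨ ·-monoʳ y₀ 0≤y₀ tb≤Aq ⟩
        y₀ · (λ i → q · A i)            ≡⟨ ·-exchange q y₀ A ⟨
        q · (λ j → y₀ · column j)       ≤⟨ ·-monoʳ q 0≤q packs₀ ⟩
        q · c                           ∎
        where open ℚ.≤-Reasoning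
    by-cases (no t≢0) =
      -- The roles are exchanged: multipliers of the capacity constraints become the cover,
      -- multipliers of the cover constraints become the packing.
      (λ j → s * q j) , (λ i → s * p i) ,
      ((λ j → 0≤p*q 0≤s (0≤q j)) , λ i →
        subst₂ _≤_ (s*[t*]≡ (b i)) (sym (·-assoc s q (A i))) (scaled (tb≤Aq i))) ,
      ((λ i → 0≤p*q 0≤s (0≤p i)) , λ j →
        subst₂ _≤_ (sym (·-assoc s p (column j))) (s*[t*]≡ (c j)) (scaled (pA≤tc j))) ,
      subst₂ _≤_ (sym (·-assoc s q c)) (sym (·-assoc s p b)) (scaled (ℚ.<⇒≤ qc<pb))
      where
      s : ℚ
      s = inv t
      0≤s : 0ℚ ≤ s
      0≤s = 0≤inv (ℚ.≰⇒> (λ t≤0 → t≢0 (ℚ.≤-antisym t≤0 0≤t)))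
      scaled : ∀ {u v} → u ≤ v → s * u ≤ s * v
      scaled = ℚ.*-monoˡ-≤-nonNeg s {{nonNegative 0≤s}}
      s*[t*]≡ : ∀ u → s * (t * u) ≡ u
      s*[t*]≡ u = trans (sym (ℚ.*-assoc s t u))
        (trans (cong (_* u) (trans (ℚ.*-comm s t) (*-inv t≢0))) (ℚ.*-identityˡ u))

  -- Strong duality for feasible programs: Farkas' lemma is applied to `system`, and either
  -- alternative produces an optimal pair.
  optimal : ∀ {x₀ y₀} → Covers x₀ → Packs y₀ → Optimal
  optimal covers packs =
    [ optimal-if-solvable , optimal-if-refutable covers packs ]′ (solvable⊎refutable (N ℕ.+ M) system)

  module _ {x : Vector ℚ N} {y : Vector ℚ M} (x-covers : Covers x) (y-packs : Packs y)
           (no-gap : x · c ≤ y · b) where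

    private
      slack-x : Vector ℚ N
      slack-x j = c j - y · column j
      slack-y : Vector ℚ M
      slack-y i = x · A i - b i
      0≤xs : ∀ j → 0ℚ ≤ x j * slack-x j
      0≤xs j = 0≤p*q (proj₁ x-covers j) (0≤q-p (proj₂ y-packs j))
      0≤ys : ∀ i → 0ℚ ≤ y i * slack-y i
      0≤ys i = 0≤p*q (proj₁ y-packs i) (0≤q-p (proj₂ x-covers i))
      ·-distribˡ-- : ∀ {n} (w u v : Vector ℚ n) → w · (λ i → u i - v i) ≡ w · u - w · v
      ·-distribˡ-- w u v = trans (·-distribˡ-+ w u (λ i → - v i)) (cong (λ a → w · u + a) (·-neg w v))
      -- The mixed term in `x`, `A` and `y` occurs in the two slack sums with opposite signs, which
      -- leaves `x · c - y · b`.
      total : x · slack-x + y · slack-y ≤ 0ℚ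
      total = subst (_≤ 0ℚ)
        (sym (trans (cong₂ _+_ (·-distribˡ-- x c (λ j → y · column j)) (·-distribˡ-- y (λ i → x · A i) b))
          (trans (cong (λ u → (x · c - x · (λ j → y · column j)) + (u - y · b)) (sym (·-exchange x y A)))
            (telescope (x · c) (x · (λ j → y · column j)) (y · b)))))
        (subst (x · c - y · b ≤_) (ℚ.+-inverseʳ (y · b)) (ℚ.+-monoˡ-≤ (- (y · b)) no-gap))
        where
        telescope : ∀ a u d → (a - u) + (u - d) ≡ a - d
        telescope = solve 3 (λ a u d → (a :- u) :+ (u :- d) := a :- d) refl

    -- Complementary slackness: both slack sums have nonnegative terms and together they are at most
    -- 0, so every single term vanishes.
    complementary-x : ∀ j → x j * (c j - y · column j) ≡ 0ℚ
    complementary-x = nonneg-sum≤0 (λ j → x j * slack-x j) 0≤xs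
      (ℚ.≤-trans (subst (_≤ x · slack-x + y · slack-y) (ℚ.+-identityʳ _)
        (ℚ.+-monoʳ-≤ (x · slack-x) (sum-nonneg 0≤ys))) total)

    complementary-y : ∀ i → y i * (x · A i - b i) ≡ 0ℚ
    complementary-y = nonneg-sum≤0 (λ i → y i * slack-y i) 0≤ys
      (ℚ.≤-trans (subst (_≤ x · slack-x + y · slack-y) (ℚ.+-identityˡ _)
        (ℚ.+-monoˡ-≤ (y · slack-y) (sum-nonneg 0≤xs))) total)

-- Levels and random labels

ι : ℕ → ℚ
ι zero    = 0ℚ
ι (suc n) = 1ℚ + ι n

ι-+ : ∀ m n → ι (m ℕ.+ n) ≡ ι m + ι n
ι-+ zero    n = sym (ℚ.+-identityˡ (ι n))
ι-+ (suc m) n = trans (cong (λ q → 1ℚ + q) (ι-+ m n)) (sym (ℚ.+-assoc 1ℚ (ι m) (ι n)))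

0≤1 : 0ℚ ≤ 1ℚ
0≤1 = ℚ.nonNegative⁻¹ 1ℚ

ι-mono-≤ : ∀ {m n} → m ℕ.≤ n → ι m ≤ ι n
ι-mono-≤ {n = zero}  z≤n       = ℚ.≤-refl
ι-mono-≤ {n = suc n} z≤n       = 0≤p+q 0≤1 (ι-mono-≤ {n = n} z≤n)
ι-mono-≤             (s≤s m≤n) = ℚ.+-monoʳ-≤ 1ℚ (ι-mono-≤ m≤n)

n<1+n : ∀ n → ι n < ι (suc n)
n<1+n n = subst (_< ι (suc n)) (ℚ.+-identityˡ (ι n)) (ℚ.+-monoˡ-< (ι n) (ℚ.positive⁻¹ 1ℚ))

ι-cancel-≤ : ∀ {m n} → ι m ≤ ι n → m ℕ.≤ n
ι-cancel-≤ {m} {n} ιm≤ιn = ℕ.≮⇒≥ λ n<m →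
  ℚ.<-irrefl refl (ℚ.<-≤-trans (n<1+n n) (ℚ.≤-trans (ι-mono-≤ n<m) ιm≤ιn))

ι-cancel-< : ∀ {m n} → ι m < ι n → m ℕ.< n
ι-cancel-< {m} {n} ιm<ιn = ℕ.≰⇒> λ n≤m →
  ℚ.<-irrefl refl (ℚ.<-≤-trans ιm<ιn (ι-mono-≤ n≤m))

indicator : Bool → ℚ
indicator b = if b then 1ℚ else 0ℚ

-- The value is the number of odd numbers at most t, capped; the summand 1 ⊓ value
-- merges the bounds 0 ≤ t (value 0) and 2 · value - 1 ≤ t.
record Level (cap : ℕ) (t : ℚ) : Set where
  field
    value : ℕ
    value≤cap : value ℕ.≤ cap
    lower : ι (value ℕ.+ value) ≤ t + ι (1 ⊓ value)
    upper : value ≡ cap ⊎ t < ι (suc (value ℕ.+ value))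

-- The largest threshold `2 cap - 1` is tested first, and the cap is lowered when the test fails. If
-- the recursive value sits at the lowered cap, the failed test supplies its strict upper bound.
level : ∀ cap {t} → 0ℚ ≤ t → Level cap t
level zero 0≤t = record
  { value = 0 ; value≤cap = z≤n ; lower = 0≤p+q 0≤t ℚ.≤-refl ; upper = inj₁ refl }
level (suc n) {t} 0≤t with ι (suc (n ℕ.+ n)) ℚ.≤? t
... | yes odd≤t = record
  { value = suc n ; value≤cap = ℕ.≤-refl
  ; lower = subst (λ m → ι (suc m) ≤ t + ι 1) (sym (ℕ.+-suc n n))
      (subst (_≤ t + ι 1) (ℚ.+-comm (ι (suc (n ℕ.+ n))) 1ℚ) (ℚ.+-monoˡ-≤ 1ℚ odd≤t))
  ; upper = inj₁ refl }
... | no odd≰t = record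
  { value = value ; value≤cap = ℕ.m≤n⇒m≤1+n value≤cap ; lower = lower
  ; upper = inj₂ ([ (λ v≡n → subst (λ m → t < ι (suc (m ℕ.+ m))) (sym v≡n) (ℚ.≰⇒> odd≰t)) , id ]′ upper) }
  where open Level (level n 0≤t)

-- At `t = 0` the lower bound says that twice the value is at most `1 ⊓ value`. Used to see that
-- arcs with `x e = 0` are never cut.
level-of-zero : ∀ {cap t} (l : Level cap t) → t ≡ 0ℚ → Level.value l ≡ 0
level-of-zero l refl = double≤min (ι-cancel-≤ (subst (ι (value ℕ.+ value) ≤_) (ℚ.+-identityˡ (ι (1 ⊓ value))) lower))
  where
  open Level l
  double≤min : ∀ {i} → i ℕ.+ i ℕ.≤ 1 ⊓ i → i ≡ 0
  double≤min {zero}  _ = refl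
  double≤min {suc i} (s≤s 2i+1≤0) with () ← subst (ℕ._≤ 0) (ℕ.+-suc i i) 2i+1≤0

-- The condition is q - p ≤ l - 5, where p and q are the labels of the tail and the head.
deletes : ℕ → ℕ → ℕ → Bool
deletes l p q = q ℕ.+ 5 ≤ᵇ l ℕ.+ p

kept : ∀ l p q → deletes l p q ≡ false → l ℕ.+ p ℕ.< q ℕ.+ 5
kept l p q eq = ℕ.≰⇒> λ q+5≤l+p → subst T eq (ℕ.≤⇒≤ᵇ q+5≤l+p)

fifths : Vector ℚ 5
fifths _ = + 1 / 5

mean : Vector ℚ 5 → ℚ
mean f = fifths · f

-- The number of the 25 label pairs `(p, q)` with `q - p ≤ l - 5`: partial sums of 1, 2, 3, 4, 5, 4,
-- 3, 2, 1, which count the pairs with each difference from -4 to 4.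
deletingPairs : ℕ → ℕ
deletingPairs 0 = 0
deletingPairs 1 = 1
deletingPairs 2 = 3
deletingPairs 3 = 6
deletingPairs 4 = 10
deletingPairs 5 = 15
deletingPairs 6 = 19
deletingPairs 7 = 22
deletingPairs 8 = 24
deletingPairs _ = 25

abstract
  probability : ℕ → ℚ
  probability l = mean λ i → mean λ j → indicator (deletes l (toℕ i) (toℕ j))

  probability-mean : ∀ l →
    mean (λ i → mean λ j → indicator (deletes l (toℕ i) (toℕ j))) ≡ probability l
  probability-mean l = refl

  probability≡ : ∀ {l} → l ℕ.< 10 → probability l ≡ ι (deletingPairs l) * (+ 1 / 25)
  probability≡ = from-yes (ℕ.allUpTo? (λ l → probability l ℚ.≟ ι (deletingPairs l) * (+ 1 / 25)) 10)

  probability-0 : probability 0 ≡ 0ℚ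
  probability-0 = refl

-- An exhaustive check of the levels 0 to 9. The hypothesis is what the three lower bounds give when
-- the scaled values add up to 27. The bound 45 is attained, for instance by levels 5, 5, 5 and by
-- 7, 7, 1.
deletingPairs-sum≤45 : ∀ {i} → i ℕ.< 10 → ∀ {j} → j ℕ.< 10 → ∀ {k} → k ℕ.< 10 →
  (i ℕ.+ i) ℕ.+ (j ℕ.+ j) ℕ.+ (k ℕ.+ k) ℕ.≤ 27 ℕ.+ ((1 ⊓ i) ℕ.+ (1 ⊓ j) ℕ.+ (1 ⊓ k)) →
  deletingPairs i ℕ.+ deletingPairs j ℕ.+ deletingPairs k ℕ.≤ 45
deletingPairs-sum≤45 = from-yes
  (ℕ.allUpTo? (λ i → ℕ.allUpTo? (λ j → ℕ.allUpTo? (λ k →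
    ((i ℕ.+ i) ℕ.+ (j ℕ.+ j) ℕ.+ (k ℕ.+ k) ℕ.≤? 27 ℕ.+ ((1 ⊓ i) ℕ.+ (1 ⊓ j) ℕ.+ (1 ⊓ k)))
    →-dec (deletingPairs i ℕ.+ deletingPairs j ℕ.+ deletingPairs k ℕ.≤? 45)) 10) 10) 10)

ι-+₃ : ∀ i j k → ι (i ℕ.+ j ℕ.+ k) ≡ ι i + ι j + ι k
ι-+₃ i j k = trans (ι-+ (i ℕ.+ j) k) (cong (_+ ι k) (ι-+ i j))

module _ {t₁ t₂ t₃ : ℚ} (l₁ : Level 9 t₁) (l₂ : Level 9 t₂) (l₃ : Level 9 t₃) where

  private
    module L₁ = Level l₁
    module L₂ = Level l₂
    module L₃ = Level l₃
    i j h : ℕ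
    i = L₁.value
    j = L₂.value
    h = L₃.value

  levels-sum : ∀ n → t₁ + t₂ + t₃ ≡ ι n →
    (i ℕ.+ i) ℕ.+ (j ℕ.+ j) ℕ.+ (h ℕ.+ h) ℕ.≤ n ℕ.+ ((1 ⊓ i) ℕ.+ (1 ⊓ j) ℕ.+ (1 ⊓ h))
  levels-sum n Σt≡n = ι-cancel-≤ (begin
    ι ((i ℕ.+ i) ℕ.+ (j ℕ.+ j) ℕ.+ (h ℕ.+ h))
      ≡⟨ ι-+₃ (i ℕ.+ i) (j ℕ.+ j) (h ℕ.+ h) ⟩
    ι (i ℕ.+ i) + ι (j ℕ.+ j) + ι (h ℕ.+ h)
      ≤⟨ ℚ.+-mono-≤ (ℚ.+-mono-≤ L₁.lower L₂.lower) L₃.lower ⟩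
    (t₁ + ι (1 ⊓ i)) + (t₂ + ι (1 ⊓ j)) + (t₃ + ι (1 ⊓ h))
      ≡⟨ regroup t₁ (ι (1 ⊓ i)) t₂ (ι (1 ⊓ j)) t₃ (ι (1 ⊓ h)) ⟩
    (t₁ + t₂ + t₃) + (ι (1 ⊓ i) + ι (1 ⊓ j) + ι (1 ⊓ h))
      ≡⟨ cong₂ _+_ Σt≡n (sym (ι-+₃ (1 ⊓ i) (1 ⊓ j) (1 ⊓ h))) ⟩
    ι n + ι ((1 ⊓ i) ℕ.+ (1 ⊓ j) ℕ.+ (1 ⊓ h))
      ≡⟨ ι-+ n ((1 ⊓ i) ℕ.+ (1 ⊓ j) ℕ.+ (1 ⊓ h)) ⟨
    ι (n ℕ.+ ((1 ⊓ i) ℕ.+ (1 ⊓ j) ℕ.+ (1 ⊓ h))) ∎)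
    where
    open ℚ.≤-Reasoning
    regroup : ∀ a a′ b b′ c c′ → (a + a′) + (b + b′) + (c + c′) ≡ (a + b + c) + (a′ + b′ + c′)
    regroup = solve 6 (λ a a′ b b′ c c′ →
      (a :+ a′) :+ (b :+ b′) :+ (c :+ c′) := (a :+ b :+ c) :+ (a′ :+ b′ :+ c′)) refl

  probability-sum : t₁ + t₂ + t₃ ≡ ι 27 →
    probability i + probability j + probability h ≤ + 9 / 5
  probability-sum Σt≡27 = begin
    probability i + probability j + probability h
      ≡⟨ cong₂ _+_ (cong₂ _+_ (probability≡ (s≤s L₁.value≤cap)) (probability≡ (s≤s L₂.value≤cap)))
           (probability≡ (s≤s L₃.value≤cap)) ⟩
    ι (deletingPairs i) * r + ι (deletingPairs j) * r + ι (deletingPairs h) * r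
      ≡⟨ factor-out (ι (deletingPairs i)) (ι (deletingPairs j)) (ι (deletingPairs h)) r ⟩
    (ι (deletingPairs i) + ι (deletingPairs j) + ι (deletingPairs h)) * r
      ≡⟨ cong (_* r) (ι-+₃ (deletingPairs i) (deletingPairs j) (deletingPairs h)) ⟨
    ι (deletingPairs i ℕ.+ deletingPairs j ℕ.+ deletingPairs h) * r
      ≤⟨ ℚ.*-monoʳ-≤-nonNeg r (ι-mono-≤ (deletingPairs-sum≤45 (s≤s L₁.value≤cap)
           (s≤s L₂.value≤cap) (s≤s L₃.value≤cap) (levels-sum 27 Σt≡27))) ⟩
    ι 45 * r
      ≡⟨⟩
    + 9 / 5 ∎
    where
    open ℚ.≤-Reasoning
    r : ℚ
    r = + 1 / 25
    factor-out : ∀ a b c r → a * r + b * r + c * r ≡ (a + b + c) * r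
    factor-out = solve 4 (λ a b c r → a :* r :+ b :* r :+ c :* r := (a :+ b :+ c) :* r) refl

  -- Around a closed triangle the labels cancel, so three kept arcs would have levels
  -- adding up to at most 12, whereas t₁ + t₂ + t₃ ≥ 27 forces a sum of at least 13.
  not-all-kept : ι 27 ≤ t₁ + t₂ + t₃ → (p q r : Fin 5) →
    deletes i (toℕ p) (toℕ q) ≡ false → deletes j (toℕ q) (toℕ r) ≡ false →
    deletes h (toℕ r) (toℕ p) ≡ false → ⊥
  not-all-kept 27≤Σt p q r e₁ e₂ e₃ = ℕ.<-irrefl refl (ℕ.≤-trans 24<2Σ (ℕ.*-monoʳ-≤ 2 Σ≤12))
    where
    -- At the cap 9 every pair of labels deletes the arc, since labels are at most 4. A kept arc
    -- therefore has the strict upper bound of its level rather than the capped alternative.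
    kept⇒≢9 : ∀ {l} (p q : Fin 5) → l ℕ.+ toℕ p ℕ.< toℕ q ℕ.+ 5 → l ≢ 9
    kept⇒≢9 p q lt refl = ℕ.<-irrefl refl (ℕ.≤-trans (ℕ.≤-trans (s≤s (ℕ.m≤m+n 9 (toℕ p))) lt)
      (ℕ.+-monoˡ-≤ 5 (Fin.toℕ≤pred[n] q)))
    below : ∀ {t} (l : Level 9 t) (p q : Fin 5) → deletes (Level.value l) (toℕ p) (toℕ q) ≡ false →
      t < ι (suc (Level.value l ℕ.+ Level.value l))
    below l p q e = [ (λ l≡9 → ⊥-elim (kept⇒≢9 p q (kept _ (toℕ p) (toℕ q) e) l≡9)) , id ]′
      (Level.upper l)
    open ℕSolver.+-*-Solver using () renaming (solve to nat-solve; _:+_ to _⊞_; _:*_ to _⊠_; con to nat; _:=_ to _≣_)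
    24<2Σ : 24 ℕ.< 2 ℕ.* (i ℕ.+ j ℕ.+ h)
    24<2Σ = ℕ.+-cancelˡ-< 3 _ _ (subst (27 ℕ.<_)
      (nat-solve 3 (λ i j h → (nat 1 ⊞ (i ⊞ i)) ⊞ (nat 1 ⊞ (j ⊞ j)) ⊞ (nat 1 ⊞ (h ⊞ h)) ≣
        nat 3 ⊞ nat 2 ⊠ (i ⊞ j ⊞ h)) refl i j h)
      (ι-cancel-< (subst (ι 27 <_)
        (sym (ι-+₃ (suc (i ℕ.+ i)) (suc (j ℕ.+ j)) (suc (h ℕ.+ h))))
        (ℚ.≤-<-trans 27≤Σt
          (ℚ.+-mono-< (ℚ.+-mono-< (below l₁ p q e₁) (below l₂ q r e₂)) (below l₃ r p e₃))))))
    -- Each strict inequality of a kept arc contributes 1 on the left; adding all three cancels the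
    -- labels and leaves `i + j + h + 3 ≤ 15`.
    Σ≤12 : i ℕ.+ j ℕ.+ h ℕ.≤ 12
    Σ≤12 = ℕ.+-cancelʳ-≤ (3 ℕ.+ (toℕ p ℕ.+ toℕ q ℕ.+ toℕ r)) _ _ (subst₂ ℕ._≤_
      (nat-solve 6 (λ i j h p q r →
        (nat 1 ⊞ (i ⊞ p)) ⊞ (nat 1 ⊞ (j ⊞ q)) ⊞ (nat 1 ⊞ (h ⊞ r)) ≣
        (i ⊞ j ⊞ h) ⊞ (nat 3 ⊞ (p ⊞ q ⊞ r))) refl i j h (toℕ p) (toℕ q) (toℕ r))
      (nat-solve 3 (λ p q r → (q ⊞ nat 5) ⊞ (r ⊞ nat 5) ⊞ (p ⊞ nat 5) ≣
        nat 12 ⊞ (nat 3 ⊞ (p ⊞ q ⊞ r))) refl (toℕ p) (toℕ q) (toℕ r))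
      (ℕ.+-mono-≤ (ℕ.+-mono-≤ (kept i (toℕ p) (toℕ q) e₁) (kept j (toℕ q) (toℕ r) e₂))
        (kept h (toℕ r) (toℕ p) e₃)))

-- The expectation over independent uniform labels, as nested averages over one label after another;
-- the inner ones are the conditional expectations used to choose labels greedily.
expectation : ∀ n → (Vector (Fin 5) n → ℚ) → ℚ
expectation zero    φ = φ (λ ())
expectation (suc n) φ = mean λ i → expectation n λ s → φ (i Vector.∷ s)

mean-cong : ∀ {f g} → f ≗ g → mean f ≡ mean g
mean-cong f≗g = sum-cong-≗ (λ i → cong (+ 1 / 5 *_) (f≗g i))

mean-const : ∀ c → mean (λ _ → c) ≡ c
mean-const c = trans (sym (*-distribʳ-sum c fifths)) (ℚ.*-identityˡ c)

expectation-const : ∀ n c → expectation n (λ _ → c) ≡ c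
expectation-const zero    c = refl
expectation-const (suc n) c = trans (mean-cong (λ i → expectation-const n c)) (mean-const c)

expectation-one : ∀ {n} (h : Fin 5 → ℚ) (u : Fin n) → expectation n (λ s → h (s u)) ≡ mean h
expectation-one {suc n} h zero    = mean-cong (λ i → expectation-const n (h i))
expectation-one {suc n} h (suc u) = trans (mean-cong (λ i → expectation-one h u)) (mean-const (mean h))

-- Labels of distinct vertices are independent, and all other labels average out.
expectation-two : ∀ {n} (h : Fin 5 → Fin 5 → ℚ) {u v : Fin n} → u ≢ v →
  expectation n (λ s → h (s u) (s v)) ≡ mean (λ i → mean (λ j → h i j))
expectation-two h {zero} {zero} u≢v = ⊥-elim (u≢v refl)
expectation-two h {zero} {suc v} _ = mean-cong (λ i → expectation-one (h i) v)
-- Here the label of `v` is averaged outermost, in the opposite order to the right-hand side, so the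
-- two averages are interchanged.
expectation-two h {suc u} {zero} _ = trans
  (mean-cong (λ j → expectation-one (λ i → h i j) u))
  (·-exchange fifths fifths h)
expectation-two h {suc u} {suc v} u≢v = trans
  (mean-cong (λ i → expectation-two h (u≢v ∘ cong suc)))
  (mean-const _)

-- Linearity of expectation.
expectation-· : ∀ {n m} (w : Vector ℚ m) (φ : Fin m → Vector (Fin 5) n → ℚ) →
  expectation n (λ s → w · (λ e → φ e s)) ≡ w · (λ e → expectation n (φ e))
expectation-· {zero}  w φ = refl
expectation-· {suc n} w φ = trans
  (mean-cong (λ i → expectation-· w (λ e s → φ e (i Vector.∷ s))))
  (·-exchange fifths w (λ e i → expectation n (λ s → φ e (i Vector.∷ s))))

minimum : ∀ {n} (f : Vector ℚ (suc n)) → Σ (Fin (suc n)) λ i → ∀ j → f i ≤ f j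
minimum {zero}  f = zero , λ { zero → ℚ.≤-refl }
minimum {suc n} f with i , least ← minimum (f ∘ suc) with ℚ.≤-total (f zero) (f (suc i))
... | inj₁ f₀≤ = zero , λ { zero → ℚ.≤-refl ; (suc j) → ℚ.≤-trans f₀≤ (least j) }
... | inj₂ ≤f₀ = suc i , λ { zero → ≤f₀ ; (suc j) → least j }

least≤mean : ∀ f {i} → (∀ j → f i ≤ f j) → f i ≤ mean f
least≤mean f {i} least = begin
  f i               ≡⟨ mean-const (f i) ⟨
  mean (λ _ → f i)  ≤⟨ ·-monoʳ fifths {λ _ → f i} {f} (λ _ → ℚ.nonNegative⁻¹ (+ 1 / 5)) least ⟩
  mean f            ∎
  where open ℚ.≤-Reasoning

-- The method of conditional expectations: the first label minimizes the conditional expectation,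
-- which is then at most its mean, and the remaining labels are chosen recursively.
at-most-expectation : ∀ n (φ : Vector (Fin 5) n → ℚ) →
  Σ (Vector (Fin 5) n) λ s → φ s ≤ expectation n φ
at-most-expectation zero    φ = (λ ()) , ℚ.≤-refl
at-most-expectation (suc n) φ = i Vector.∷ s , ℚ.≤-trans φs≤ (least≤mean conditional least)
  where
  conditional : Vector ℚ 5
  conditional i = expectation n (λ s → φ (i Vector.∷ s))
  i : Fin 5
  i = proj₁ (minimum conditional)
  least : ∀ j → conditional i ≤ conditional j
  least = proj₂ (minimum conditional)
  s : Vector (Fin 5) n
  s = proj₁ (at-most-expectation n (λ s → φ (i Vector.∷ s)))
  φs≤ : φ (i Vector.∷ s) ≤ conditional i
  φs≤ = proj₂ (at-most-expectation n (λ s → φ (i Vector.∷ s)))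

-- Triangles

Σℚ≡sum : ∀ {m} (f : Vector ℚ m) → Σℚ f ≡ sum f
Σℚ≡sum {zero}  f = refl
Σℚ≡sum {suc m} f = cong (λ q → f zero + q) (Σℚ≡sum (f ∘ suc))

Σℚ-cong : ∀ {m} {f g : Vector ℚ m} → f ≗ g → Σℚ f ≡ Σℚ g
Σℚ-cong {zero}  f≗g = refl
Σℚ-cong {suc m} f≗g = cong₂ _+_ (f≗g zero) (Σℚ-cong (f≗g ∘ suc))

sum-combine : ∀ m {n} (f : Vector ℚ (m ℕ.* n)) →
  sum f ≡ sum (λ i → sum (λ j → f (combine {m} {n} i j)))
sum-combine zero    f = refl
sum-combine (suc m) {n} f = trans (sum-↑ n f)
  (cong (λ q → sum (λ j → f (j ↑ˡ (m ℕ.* n))) + q) (sum-combine m (λ i → f (n ↑ʳ i))))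

if-* : ∀ (b : Bool) q → (if b then q else 0ℚ) ≡ q * indicator b
if-* true  q = sym (ℚ.*-identityʳ q)
if-* false q = sym (ℚ.*-zeroʳ q)

δ-refl : ∀ {n} (i : Fin n) → δ i i ≡ 1ℚ
δ-refl zero    = refl
δ-refl (suc i) = δ-refl i

δ-≢ : ∀ {n} {i j : Fin n} → j ≢ i → δ i j ≡ 0ℚ
δ-≢ {i = zero}  {zero}  j≢i = ⊥-elim (j≢i refl)
δ-≢ {i = zero}  {suc j} _   = refl
δ-≢ {i = suc i} {zero}  _   = refl
δ-≢ {i = suc i} {suc j} j≢i = δ-≢ (j≢i ∘ cong suc)

-- Distinctness lets at most one of the three comparisons succeed, so the membership indicator is a
-- sum of unit vectors and can be handled linearly.
contains-δ : ∀ {m} {a b c : Fin m} → a ≢ b → b ≢ c → a ≢ c → ∀ e →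
  indicator (contains e a b c) ≡ δ a e + δ b e + δ c e
contains-δ {a = a} {b} {c} a≢b b≢c a≢c e with e Fin.≟ a | e Fin.≟ b | e Fin.≟ c
... | yes refl | yes refl | _        = ⊥-elim (a≢b refl)
... | yes refl | no _     | yes refl = ⊥-elim (a≢c refl)
... | no _     | yes refl | yes refl = ⊥-elim (b≢c refl)
... | yes refl | no e≢b   | no e≢c   = sym (cong₂ _+_ (cong₂ _+_ (δ-refl e) (δ-≢ e≢b)) (δ-≢ e≢c))
... | no e≢a   | yes refl | no e≢c   = sym (cong₂ _+_ (cong₂ _+_ (δ-≢ e≢a) (δ-refl e)) (δ-≢ e≢c))
... | no e≢a   | no e≢b   | yes refl = sym (cong₂ _+_ (cong₂ _+_ (δ-≢ e≢a) (δ-≢ e≢b)) (δ-refl e))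
... | no e≢a   | no e≢b   | no e≢c   = sym (cong₂ _+_ (cong₂ _+_ (δ-≢ e≢a) (δ-≢ e≢b)) (δ-≢ e≢c))

·-contains : ∀ {m} (u : Vector ℚ m) {a b c} → a ≢ b → b ≢ c → a ≢ c →
  u · (λ e → indicator (contains e a b c)) ≡ u a + u b + u c
·-contains u {a} {b} {c} a≢b b≢c a≢c = begin
  u · (λ e → indicator (contains e a b c))
    ≡⟨ sum-cong-≗ (λ e → cong (u e *_) (contains-δ a≢b b≢c a≢c e)) ⟩
  u · (λ e → δ a e + δ b e + δ c e)
    ≡⟨ ·-distribˡ-+ u (λ e → δ a e + δ b e) (δ c) ⟩
  u · (λ e → δ a e + δ b e) + u · δ c
    ≡⟨ cong (_+ u · δ c) (·-distribˡ-+ u (δ a) (δ b)) ⟩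
  u · δ a + u · δ b + u · δ c
    ≡⟨ cong₂ _+_ (cong₂ _+_ (·δ a) (·δ b)) (·δ c) ⟩
  u a + u b + u c ∎
  where
  open ≡-Reasoning
  ·δ : ∀ i → u · δ i ≡ u i
  ·δ i = trans (·-comm u (δ i)) (δ·≡ i u)

p-q≡0⇒p≡q : ∀ p q → p - q ≡ 0ℚ → p ≡ q
p-q≡0⇒p≡q p q p-q≡0 = trans (restore p q) (trans (cong (_+ q) p-q≡0) (ℚ.+-identityˡ q))
  where
  restore : ∀ p q → p ≡ (p - q) + q
  restore = solve 2 (λ p q → p := (p :- q) :+ q) refl

*-cancel-≡0 : ∀ {p q} → p ≢ 0ℚ → p * q ≡ 0ℚ → q ≡ 0ℚ
*-cancel-≡0 {p} {q} p≢0 pq≡0 = begin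
  q                ≡⟨ ℚ.*-identityˡ q ⟨
  1ℚ * q           ≡⟨ cong (_* q) (*-inv p≢0) ⟨
  p * inv p * q    ≡⟨ reorder p (inv p) q ⟩
  inv p * (p * q)  ≡⟨ cong (inv p *_) pq≡0 ⟩
  inv p * 0ℚ       ≡⟨ ℚ.*-zeroʳ (inv p) ⟩
  0ℚ               ∎
  where
  open ≡-Reasoning
  reorder : ∀ p i q → p * i * q ≡ i * (p * q)
  reorder = solve 3 (λ p i q → p :* i :* q := i :* (p :* q)) refl

module _ (D : Digraph) where

  private
    K : ℕ
    K = k D

    Arc : Set
    Arc = Fin K

  abstract
    canonical? : ∀ a b c → Dec (IsCanonTri D a b c)
    canonical? a b c =
      ((head D a Fin.≟ tail D b) ×-dec (head D b Fin.≟ tail D c) ×-dec (head D c Fin.≟ tail D a)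
        ×-dec ¬? (tail D a Fin.≟ tail D b) ×-dec ¬? (tail D b Fin.≟ tail D c)
        ×-dec ¬? (tail D a Fin.≟ tail D c))
      ×-dec (toℕ a ℕ.<? toℕ b) ×-dec (toℕ a ℕ.<? toℕ c)

  arcs-distinct : ∀ {a b c} → IsTri D a b c → a ≢ b × b ≢ c × a ≢ c
  arcs-distinct (_ , _ , _ , ab , bc , ac) =
    ab ∘ cong (tail D) , bc ∘ cong (tail D) , ac ∘ cong (tail D)

  rotate : ∀ {a b c} → IsTri D a b c → IsTri D b c a
  rotate (ab , bc , ca , a≢b , b≢c , a≢c) = bc , ca , ab , b≢c , a≢c ∘ sym , a≢b ∘ sym

  -- The three arcs are distinct, so one has strictly smallest index and can be rotated to the
  -- front. This passes from the constraints on canonical triples to arbitrary triangles.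
  canonical-rotation : ∀ {a b c} → IsTri D a b c →
    IsCanonTri D a b c ⊎ IsCanonTri D b c a ⊎ IsCanonTri D c a b
  canonical-rotation {a} {b} {c} tri with a≢b , b≢c , a≢c ← arcs-distinct tri
    with ℕ.≤-total (toℕ a) (toℕ b)
  ... | inj₁ a≤b with ℕ.≤-total (toℕ a) (toℕ c)
  ...   | inj₁ a≤c = inj₁ (tri , Fin.≤∧≢⇒< a≤b a≢b , Fin.≤∧≢⇒< a≤c a≢c)
  ...   | inj₂ c≤a = inj₂ (inj₂ (rotate (rotate tri) ,
    Fin.≤∧≢⇒< c≤a (a≢c ∘ sym) , Fin.≤∧≢⇒< (ℕ.≤-trans c≤a a≤b) (b≢c ∘ sym)))
  canonical-rotation {a} {b} {c} tri | inj₂ b≤a with ℕ.≤-total (toℕ b) (toℕ c)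
  ...   | inj₁ b≤c = inj₂ (inj₁ (rotate tri , Fin.≤∧≢⇒< b≤c b≢c , Fin.≤∧≢⇒< b≤a (a≢b ∘ sym)))
  ...   | inj₂ c≤b = inj₂ (inj₂ (rotate (rotate tri) ,
    Fin.≤∧≢⇒< (ℕ.≤-trans c≤b b≤a) (a≢c ∘ sym) , Fin.≤∧≢⇒< c≤b (b≢c ∘ sym)))

  canonical : Arc → Arc → Arc → ℚ
  canonical a b c = indicator (does (canonical? a b c))

  Triple : ℕ
  Triple = K ℕ.* (K ℕ.* K)

  encode : Arc → Arc → Arc → Fin Triple
  encode a b c = combine a (combine b c)

  decode : Fin Triple → Arc × Arc × Arc
  decode t = map₂ (remQuot {K} K) (remQuot {K} (K ℕ.* K) t)

  decode-encode : ∀ a b c → decode (encode a b c) ≡ (a , b , c)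
  decode-encode a b c = trans
    (cong (map₂ (remQuot {K} K)) (Fin.remQuot-combine {K} {K ℕ.* K} a (combine b c)))
    (cong (a ,_) (Fin.remQuot-combine {K} {K} b c))

  onTriple : {X : Set} → (Arc → Arc → Arc → X) → Fin Triple → X
  onTriple f t = f (proj₁ (decode t)) (proj₁ (proj₂ (decode t))) (proj₂ (proj₂ (decode t)))

  onTriple-encode : ∀ {X : Set} (f : Arc → Arc → Arc → X) a b c → onTriple f (encode a b c) ≡ f a b c
  onTriple-encode f a b c =
    cong (λ (a , b , c) → f a b c) (decode-encode a b c)

  -- The program has a row for every triple of arcs. If the triple is not a canonical triangle, its
  -- row and its entry in `isTriangle` are zero, so its covering constraint reads `0 ≤ 0`.
  incidence : Fin Triple → Arc → ℚ
  incidence t e = onTriple (λ a b c → canonical a b c * indicator (contains e a b c)) t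

  isTriangle : Vector ℚ Triple
  isTriangle = onTriple canonical

  -- For `x` this is the amount by which a triangle is covered, for the cutting probabilities its
  -- expected number of cut arcs. Distinct arcs make each count once; off the canonical triples both
  -- sides vanish.
  ·-incidence : ∀ u t →
    u · incidence t ≡ onTriple (λ a b c → canonical a b c * (u a + u b + u c)) t
  ·-incidence u t = at (proj₁ (decode t)) (proj₁ (proj₂ (decode t))) (proj₂ (proj₂ (decode t)))
    where
    at : ∀ a b c → u · (λ e → canonical a b c * indicator (contains e a b c)) ≡
      canonical a b c * (u a + u b + u c)
    at a b c with canonical? a b c
    ... | no _ = trans
      (sum-cong-≗ (λ e → trans
        (cong (u e *_) (ℚ.*-zeroˡ (indicator (contains e a b c)))) (ℚ.*-zeroʳ (u e))))
      (trans (sum-replicate-zero K) (sym (ℚ.*-zeroˡ (u a + u b + u c))))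
    ... | yes (tri , _) with a≢b , b≢c , a≢c ← arcs-distinct tri =
      trans (sum-cong-≗ (λ e → cong (u e *_) (ℚ.*-identityˡ (indicator (contains e a b c)))))
        (trans (·-contains u a≢b b≢c a≢c) (sym (ℚ.*-identityˡ (u a + u b + u c))))

  sum-encode : ∀ (y : Vector ℚ Triple) (f : Arc → Arc → Arc → ℚ) →
    Σℚ (λ a → Σℚ (λ b → Σℚ (λ c → y (encode a b c) * f a b c))) ≡ y · onTriple f
  sum-encode y f = begin
    Σℚ (λ a → Σℚ (λ b → Σℚ (λ c → y (encode a b c) * f a b c)))
      ≡⟨ Σℚ-cong (λ a → Σℚ-cong (λ b → Σℚ-cong (λ c →
           cong (y (encode a b c) *_) (sym (onTriple-encode f a b c))))) ⟩
    Σℚ (λ a → Σℚ (λ b → Σℚ (λ c → g (encode a b c))))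
      ≡⟨ Σℚ-cong (λ a → Σℚ-cong (λ b → Σℚ≡sum (λ c → g (encode a b c)))) ⟩
    Σℚ (λ a → Σℚ (λ b → sum (λ c → g (encode a b c))))
      ≡⟨ Σℚ-cong (λ a → Σℚ≡sum (λ b → sum (λ c → g (encode a b c)))) ⟩
    Σℚ (λ a → sum (λ b → sum (λ c → g (encode a b c))))
      ≡⟨ Σℚ≡sum (λ a → sum (λ b → sum (λ c → g (encode a b c)))) ⟩
    sum (λ a → sum (λ b → sum (λ c → g (encode a b c))))
      ≡⟨ sum-cong-≗ (λ a → sum-combine K {K} (λ bc → g (combine {K} {K ℕ.* K} a bc))) ⟨
    sum (λ a → sum (λ bc → g (combine {K} {K ℕ.* K} a bc)))
      ≡⟨ sum-combine K {K ℕ.* K} g ⟨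
    y · onTriple f ∎
    where
    open ≡-Reasoning
    g : Vector ℚ Triple
    g t = y t * onTriple f t

  -- The triangle program and the rounding of its optimum

  module _ (w : Weight D) (0≤w : NonNegW D w) where

    open LinearProgram incidence isTriangle w

    -- Strong duality asks for feasible points. The all-ones vector covers each triangle three
    -- times; the zero packing below is feasible because weights are nonnegative.
    ones-cover : Covers (λ _ → 1ℚ)
    ones-cover = (λ _ → 0≤1) , λ t → subst (isTriangle t ≤_) (sym (·-incidence (λ _ → 1ℚ) t))
      (indicator≤3 (onTriple (λ a b c → does (canonical? a b c)) t))
      where
      indicator≤3 : ∀ b → indicator b ≤ indicator b * (1ℚ + 1ℚ + 1ℚ)
      indicator≤3 false = from-yes (indicator false ℚ.≤? indicator false * (1ℚ + 1ℚ + 1ℚ))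
      indicator≤3 true  = from-yes (indicator true ℚ.≤? indicator true * (1ℚ + 1ℚ + 1ℚ))

    zeros-pack : Packs 0s
    zeros-pack = (λ _ → ℚ.≤-refl) , λ e → subst (_≤ w e) (sym (0·≡0 (column e))) (0≤w e)

    module Rounding (x : Vector ℚ K) (y : Vector ℚ Triple) (x-covers : Covers x) (y-packs : Packs y)
                    (no-gap : x · w ≤ y · isTriangle) where

      0≤x : ∀ e → 0ℚ ≤ x e
      0≤x = proj₁ x-covers

      -- Levels change at the odd multiples of 1/27.
      abstract
        factor27 : ℚ
        factor27 = ι 27

        factor27≡27 : factor27 ≡ ι 27
        factor27≡27 = refl

      0≤factor27 : 0ℚ ≤ factor27
      0≤factor27 = subst (0ℚ ≤_) (sym factor27≡27) (ι-mono-≤ {0} {27} z≤n)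

      scaled : Arc → ℚ
      scaled e = factor27 * x e

      arcLevel : ∀ e → Level 9 (scaled e)
      arcLevel e = level 9 (0≤p*q 0≤factor27 (0≤x e))

      ℓ : Arc → ℕ
      ℓ e = Level.value (arcLevel e)

      scaled-sum : ∀ a b c → factor27 * (x a + x b + x c) ≡ scaled a + scaled b + scaled c
      scaled-sum a b c = distrib factor27 (x a) (x b) (x c)
        where
        distrib : ∀ r p q s → r * (p + q + s) ≡ r * p + r * q + r * s
        distrib = solve 4 (λ r p q s → r :* (p :+ q :+ s) := r :* p :+ r :* q :+ r :* s) refl

      cut : Vector (Fin 5) (n D) → ArcSet D
      cut s e = deletes (ℓ e) (toℕ (s (tail D e))) (toℕ (s (head D e)))

      canonical-sum≥1 : ∀ {a b c} → IsCanonTri D a b c → 1ℚ ≤ x a + x b + x c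
      canonical-sum≥1 {a} {b} {c} tri = covered (canonical? a b c)
        (subst₂ _≤_ (onTriple-encode canonical a b c)
          (trans (·-incidence x (encode a b c))
            (onTriple-encode (λ a b c → canonical a b c * (x a + x b + x c)) a b c))
          (proj₂ x-covers (encode a b c)))
        where
        covered : (d : Dec (IsCanonTri D a b c)) →
          indicator (does d) ≤ indicator (does d) * (x a + x b + x c) → 1ℚ ≤ x a + x b + x c
        covered (yes _)  le = subst (1ℚ ≤_) (ℚ.*-identityˡ (x a + x b + x c)) le
        covered (no ¬tri) _ = ⊥-elim (¬tri tri)

      triangle-sum≥1 : ∀ {a b c} → IsTri D a b c → 1ℚ ≤ x a + x b + x c
      triangle-sum≥1 {a} {b} {c} tri with canonical-rotation tri
      ... | inj₁ abc        = canonical-sum≥1 abc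
      ... | inj₂ (inj₁ bca) = subst (1ℚ ≤_) (rotate-sum (x a) (x b) (x c)) (canonical-sum≥1 bca)
        where
        rotate-sum : ∀ p q r → q + r + p ≡ p + q + r
        rotate-sum = solve 3 (λ p q r → q :+ r :+ p := p :+ q :+ r) refl
      ... | inj₂ (inj₂ cab) = subst (1ℚ ≤_) (rotate-sum (x a) (x b) (x c)) (canonical-sum≥1 cab)
        where
        rotate-sum : ∀ p q r → r + p + q ≡ p + q + r
        rotate-sum = solve 3 (λ p q r → r :+ p :+ q := p :+ q :+ r) refl

      -- The head of each arc is the tail of the next, so the three tests share their labels, and 27
      -- times the covering inequality contradicts that all arcs are kept. This holds for every
      -- labelling, not just on average.
      cut-hits : ∀ s → TriFree D (cut s)
      cut-hits s a b c tri@(ab , bc , ca , _)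
        with cut s a in ea | cut s b in eb | cut s c in ec
      ... | true  | _     | _     = inj₁ refl
      ... | false | true  | _     = inj₂ (inj₁ refl)
      ... | false | false | true  = inj₂ (inj₂ refl)
      ... | false | false | false = ⊥-elim (not-all-kept (arcLevel a) (arcLevel b) (arcLevel c)
        27≤ (s (tail D a)) (s (tail D b)) (s (tail D c))
        (follow a ab ea) (follow b bc eb) (follow c ca ec))
        where
        follow : ∀ e {v} → head D e ≡ v → cut s e ≡ false →
          deletes (ℓ e) (toℕ (s (tail D e))) (toℕ (s v)) ≡ false
        follow e refl eq = eq
        27≤ : ι 27 ≤ scaled a + scaled b + scaled c
        27≤ = subst₂ _≤_ (trans (ℚ.*-identityʳ factor27) factor27≡27) (scaled-sum a b c)
          (ℚ.*-monoˡ-≤-nonNeg factor27 {{nonNegative 0≤factor27}} (triangle-sum≥1 tri))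

      packing : TriFun D
      packing a b c = y (encode a b c) * canonical a b c

      packing-weight : packWeight D packing ≡ y · isTriangle
      packing-weight = sum-encode y canonical

      packing-load : ∀ e → load D packing e ≡ y · column e
      packing-load e = trans
        (Σℚ-cong (λ a → Σℚ-cong (λ b → Σℚ-cong (λ c →
          trans (if-* (contains e a b c) (packing a b c))
            (ℚ.*-assoc (y (encode a b c)) (canonical a b c) (indicator (contains e a b c)))))))
        (sum-encode y (λ a b c → canonical a b c * indicator (contains e a b c)))

      packing-isFracPacking : IsFracPacking D w packing
      packing-isFracPacking = nonneg , supported ,
        λ e → subst (_≤ w e) (sym (packing-load e)) (proj₂ y-packs e)
        where
        0≤indicator : ∀ b → 0ℚ ≤ indicator b
        0≤indicator false = ℚ.≤-refl
        0≤indicator true  = 0≤1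
        nonneg : ∀ a b c → 0ℚ ≤ packing a b c
        nonneg a b c = 0≤p*q (proj₁ y-packs (encode a b c)) (0≤indicator (does (canonical? a b c)))
        supported : ∀ a b c → ¬ (packing a b c ≡ 0ℚ) → IsCanonTri D a b c
        supported a b c ≢0 with canonical? a b c
        ... | yes tri = tri
        ... | no _    = ⊥-elim (≢0 (ℚ.*-zeroʳ (y (encode a b c))))

      pr : Arc → ℚ
      pr e = probability (ℓ e)

      cut-weight : ∀ s → wSet D w (cut s) ≡ w · (λ e → indicator (cut s e))
      cut-weight s = trans (Σℚ≡sum (λ e → if cut s e then w e else 0ℚ))
        (sum-cong-≗ (λ e → if-* (cut s e) (w e)))

      -- By complementary slackness w e may be replaced by the load of e wherever x e ≠ 0,
      -- while arcs with x e = 0 are never cut.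
      pr-load : ∀ e → w e * pr e ≡ pr e * (y · column e)
      pr-load e = by-cases (x e ℚ.≟ 0ℚ)
        where
        by-cases : Dec (x e ≡ 0ℚ) → w e * pr e ≡ pr e * (y · column e)
        by-cases (yes x≡0) = trans (cong (w e *_) pr≡0) (trans (ℚ.*-zeroʳ (w e))
          (sym (trans (cong (_* (y · column e)) pr≡0) (ℚ.*-zeroˡ (y · column e)))))
          where
          pr≡0 : pr e ≡ 0ℚ
          pr≡0 = trans (cong probability (level-of-zero (arcLevel e)
            (trans (cong (factor27 *_) x≡0) (ℚ.*-zeroʳ factor27)))) probability-0
        by-cases (no x≢0) = trans (ℚ.*-comm (w e) (pr e)) (cong (pr e *_)
          (p-q≡0⇒p≡q (w e) (y · column e) (*-cancel-≡0 x≢0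
            (complementary-x {x} {y} x-covers y-packs no-gap e))))

      -- If `y t` is zero, both sides vanish. Otherwise complementary slackness makes the covering
      -- constraint tight; on a canonical triangle the scaled values then add up to exactly 27, as
      -- `probability-sum` requires.
      triangle-probability : ∀ t → y t * (pr · incidence t) ≤ y t * ((+ 9 / 5) * isTriangle t)
      triangle-probability t = by-cases (y t ℚ.≟ 0ℚ)
        where
        by-cases : Dec (y t ≡ 0ℚ) → y t * (pr · incidence t) ≤ y t * ((+ 9 / 5) * isTriangle t)
        by-cases (yes y≡0) = ℚ.≤-reflexive (trans (vanish (pr · incidence t)) (sym (vanish ((+ 9 / 5) * isTriangle t))))
          where
          vanish : ∀ q → y t * q ≡ 0ℚ
          vanish q = trans (cong (_* q) y≡0) (ℚ.*-zeroˡ q)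
        by-cases (no y≢0) = ℚ.*-monoˡ-≤-nonNeg (y t) {{nonNegative (proj₁ y-packs t)}}
          (subst (_≤ (+ 9 / 5) * isTriangle t) (sym (·-incidence pr t))
            (at-triple (proj₁ (decode t)) (proj₁ (proj₂ (decode t))) (proj₂ (proj₂ (decode t)))
              (trans (sym (·-incidence x t)) (p-q≡0⇒p≡q (x · incidence t) (isTriangle t)
                (*-cancel-≡0 y≢0 (complementary-y {x} {y} x-covers y-packs no-gap t))))))
          where
          at-triple : ∀ a b c → canonical a b c * (x a + x b + x c) ≡ canonical a b c →
            canonical a b c * (pr a + pr b + pr c) ≤ (+ 9 / 5) * canonical a b c
          at-triple a b c tight with canonical? a b c
          ... | no _  = ℚ.≤-reflexive (ℚ.*-zeroˡ (pr a + pr b + pr c))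
          ... | yes _ = subst (_≤ (+ 9 / 5) * 1ℚ) (sym (ℚ.*-identityˡ (pr a + pr b + pr c)))
            (probability-sum (arcLevel a) (arcLevel b) (arcLevel c)
              (trans (sym (scaled-sum a b c)) (trans
                (cong (factor27 *_) (trans (sym (ℚ.*-identityˡ (x a + x b + x c))) tight))
                (trans (ℚ.*-identityʳ factor27) factor27≡27))))

      -- The absence of loops makes the labels at the two ends independent.
      expected-cut : ∀ e → expectation (n D) (λ s → indicator (cut s e)) ≡ pr e
      expected-cut e = trans
        (expectation-two (λ i j → indicator (deletes (ℓ e) (toℕ i) (toℕ j))) (noLoop D e))
        (probability-mean (ℓ e))

      expected-weight : expectation (n D) (λ s → w · (λ e → indicator (cut s e))) ≤
        (+ 9 / 5) * packWeight D packing
      expected-weight = begin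
        expectation (n D) (λ s → w · (λ e → indicator (cut s e)))
          ≡⟨ expectation-· w (λ e s → indicator (cut s e)) ⟩
        w · (λ e → expectation (n D) (λ s → indicator (cut s e)))
          ≡⟨ sum-cong-≗ (λ e → cong (w e *_) (expected-cut e)) ⟩
        w · pr
          -- Weights give way to packing loads; the next step regroups the sum from arcs to
          -- triangles, where the bound 9/5 applies triangle by triangle.
          ≡⟨ sum-cong-≗ pr-load ⟩
        pr · (λ e → y · column e)
          ≡⟨ ·-exchange pr y incidence ⟩
        y · (λ t → pr · incidence t)
          ≤⟨ sum-mono triangle-probability ⟩
        y · (λ t → (+ 9 / 5) * isTriangle t)
          ≡⟨ trans (·-comm y (λ t → (+ 9 / 5) * isTriangle t))
               (trans (·-assoc (+ 9 / 5) isTriangle y) (cong ((+ 9 / 5) *_) (·-comm isTriangle y))) ⟩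
        (+ 9 / 5) * (y · isTriangle)
          ≡⟨ cong ((+ 9 / 5) *_) packing-weight ⟨
        (+ 9 / 5) * packWeight D packing ∎
        where open ℚ.≤-Reasoning

      labels : Σ (Vector (Fin 5) (n D)) λ s →
        w · (λ e → indicator (cut s e)) ≤ expectation (n D) (λ s → w · (λ e → indicator (cut s e)))
      labels = at-most-expectation (n D) (λ s → w · (λ e → indicator (cut s e)))

      -- Some labelling costs at most the average, and its cut meets all triangles. The cut bounds
      -- the minimum weight from above and the packing bounds the maximum weight from below, so
      -- comparing these two suffices.
      rounded : Σ (ArcSet D) λ F → Σ (TriFun D) λ m →
        TriFree D F × IsFracPacking D w m × (wSet D w F ≤ ((+ 9) / 5) * packWeight D m)
      rounded = cut (proj₁ labels) , packing , cut-hits (proj₁ labels) , packing-isFracPacking ,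
        subst (_≤ (+ 9 / 5) * packWeight D packing) (sym (cut-weight (proj₁ labels)))
          (ℚ.≤-trans (proj₂ labels) expected-weight)

theorem3 : (D : Digraph) (w : Weight D) → NonNegW D w →
    Σ (ArcSet D) λ F → Σ (TriFun D) λ m →
    TriFree D F × IsFracPacking D w m ×
    (wSet D w F ≤ ((+ 9) / 5) * packWeight D m)
theorem3 D w 0≤w
  with x , y , covers , packs , no-gap ← LinearProgram.optimal (incidence D) (isTriangle D) w
    (ones-cover D w 0≤w) (zeros-pack D w 0≤w) =
  Rounding.rounded D w 0≤w x y covers packs no-gap
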